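{- Let $p\ge5$ be a prime, let $C\in\mathbb{F}_p$, and put $D=4-2C-\frac{C^2}{4}\in\mathbb{F}_p$. The Vieta graph of the cubic $x^2+y^2+z^2=xyz-C(x+y+z)+D$ over $\mathbb{F}_p$ satisfies the following. (a) If $C=0$: there are $p^2+1$ vertices in total, of which $6p-8$ are deficient; there are $0$ vertices of degree $2$, $6(p-2)$ vertices of degree $1$, and $4$ vertices of degree $0$. (b) If $C=8$: there are $p^2+1$ vertices in total, of which $6p-8$ are deficient; there are $3(p-2)$ vertices of degree $2$, $3(p-1)$ vertices of degree $1$, and $1$ vertex of degree $0$. (c) If $C\neq 0,8$: the total number of vertices is $p^2+1+p$ or $p^2+1-p$; there are $6p-12$ deficient vertices; there are $3(p-3)$ vertices of degree $2$, $3(p-2)$ vertices of degree $1$, and $3$ vertices of degree $0$.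
   Context: The Vieta graph of the equation $x^2+y^2+z^2=xyz-C(x+y+z)+D$ over $\mathbb{F}_p$ is the finite simple graph whose vertices are the solutions $(x,y,z)\in\mathbb{F}_p^3$, where two distinct vertices are joined by an edge whenever one is a Vieta flip of the other. The Vieta flips of $(x,y,z)$ are $(yz-C-x,y,z)$, $(x,xz-C-y,z)$, $(x,y,xy-C-z)$. Every vertex has degree at most $3$; a vertex is deficient if its degree is less than $3$. Equalities such as $C=8$ are in $\mathbb{F}_p$. -}

module Defs where

open import Data.Fin using (Fin; toℕ; _≟_)
open import Data.Fin.Properties using (any?)
open import Data.List using (List; []; _∷_; length; filter; allFin; cartesianProduct)
import Data.List.Membership.DecPropositional as DecMembership
open import Data.Nat using (ℕ; NonZero; _+_; _*_; _∸_; _<_; _<?_)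
import Data.Nat as ℕ
open import Data.Nat.DivMod using (_mod_)
open import Data.Product using (_×_; _,_)
open import Data.Product.Properties using (≡-dec)
open import Data.Sum using (_⊎_)
open import Relation.Binary.Definitions using (Decidable; DecidableEquality)
open import Relation.Binary.PropositionalEquality using (_≡_; _≢_)
open import Relation.Nullary using (Dec; yes; no; ¬?; _×-dec_; _⊎-dec_)
import Relation.Unary as U

-- Arithmetic of ℤ/p on the residues 0, …, p - 1; it is the field 𝔽_p when p
-- is prime.
module Residues (p : ℕ) .{{_ : NonZero p}} where

  𝔽 : Set
  𝔽 = Fin p

  infixl 6 _+ₚ_ _-ₚ_
  infixl 7 _*ₚ_ _/ₚ_
  infix  8 _⁻¹

  ⟦_⟧ : ℕ → 𝔽
  ⟦ n ⟧ = n mod p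

  _+ₚ_ _-ₚ_ _*ₚ_ _/ₚ_ : 𝔽 → 𝔽 → 𝔽
  _⁻¹ : 𝔽 → 𝔽

  x +ₚ y = ⟦ toℕ x + toℕ y ⟧
  x -ₚ y = ⟦ toℕ x + (p ∸ toℕ y) ⟧
  x *ₚ y = ⟦ toℕ x * toℕ y ⟧
  x /ₚ y = x *ₚ y ⁻¹

  -- The multiplicative inverse, found by search; 0 when there is none.
  x ⁻¹ with any? (λ y → x *ₚ y ≟ ⟦ 1 ⟧)
  ... | yes (y , _) = y
  ... | no  _       = ⟦ 0 ⟧

module VietaGraph (p : ℕ) .{{_ : NonZero p}} (C D : Fin p) where
  open Residues p

  Point : Set
  Point = 𝔽 × 𝔽 × 𝔽

  _≟ᴾ_ : DecidableEquality Point
  _≟ᴾ_ = ≡-dec _≟_ (≡-dec _≟_ _≟_)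

  open DecMembership _≟ᴾ_ using (_∈_; _∈?_)

  IsSolution : U.Pred Point _
  IsSolution (x , y , z) =
    x *ₚ x +ₚ y *ₚ y +ₚ z *ₚ z ≡ x *ₚ y *ₚ z -ₚ C *ₚ (x +ₚ y +ₚ z) +ₚ D

  isSolution? : U.Decidable IsSolution
  isSolution? (x , y , z) = _ ≟ _

  -- Every solution occurs exactly once.
  vertices : List Point
  vertices =
    filter isSolution?
      (cartesianProduct (allFin p) (cartesianProduct (allFin p) (allFin p)))

  flips : Point → List Point
  flips (x , y , z) =
      (y *ₚ z -ₚ C -ₚ x , y , z)
    ∷ (x , x *ₚ z -ₚ C -ₚ y , z)
    ∷ (x , y , x *ₚ y -ₚ C -ₚ z)
    ∷ []

  Adjacent : Point → Point → Set
  Adjacent v w = v ≢ w × (w ∈ flips v ⊎ v ∈ flips w)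

  adjacent? : Decidable Adjacent
  adjacent? v w = ¬? (v ≟ᴾ w) ×-dec (w ∈? flips v ⊎-dec v ∈? flips w)

  degree : Point → ℕ
  degree v = length (filter (adjacent? v) vertices)

  Deficient : U.Pred Point _
  Deficient v = degree v < 3

  deficient? : U.Decidable Deficient
  deficient? v = degree v <? 3

  #vertices : ℕ
  #vertices = length vertices

  #deficient : ℕ
  #deficient = length (filter deficient? vertices)

  #ofDegree : ℕ → ℕ
  #ofDegree d = length (filter (λ v → degree v ℕ.≟ d) vertices)

{-# OPTIONS --safe #-}
module Submission where

-- Put k = 4 - C/2 and (a, b, c) = (x + 2, y + 2, z + 2).  With s = a + b + c - k
-- the cubic becomes s² = abc, and the flips of x, y, z fix the point exactly when
-- 2s = bc, 2s = ca, 2s = ab.  The cases C = 0 and C = 8 are k = 4 and k = 0.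
--
-- Degrees: if a = 0 then s = 0, so the point lies on the line b + c = k and the
-- flips of y and z fix it.  If bc ≠ 0 and the flip of x fixes the point, then
-- 4a = bc and s = 2a, hence (b - 4)(c - 4) = 4(4 - k); this gives the vertices
-- of degree 2, and for k = 4 it degenerates to (4, b, b) and its rotations.
--
-- Total: for a, b ≠ 0 write s = ta; the equation becomes
-- a (t² - bt + b) = b (k - b), which determines a unless b = k.  The pairs
-- (b, t) to be excluded lie on the rational curve t² = b (t - 1), and b = k
-- contributes p - 1 points for each root of t² - kt + k, of which there are 0
-- or 2 when k ≠ 0, 4.

-- Expanding `(x + 2)(y + 2)(z + 2)` produces `2(xy + yz + zx)`, exactly the mixed part of the
-- square of `x + y + z` plus a constant, which is why the shift is by 2. Comparing linear terms
-- then forces `k = 4 - C/2`, and the constant terms agree precisely for `D = 4 - 2C - C²/4`. A flip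
-- exchanges the two roots of a quadratic in one coordinate, so it fixes a point when a partial
-- derivative of `s² - abc` vanishes; for the first coordinate this is `2s - bc`.
--
-- For `k ≠ 0` let `n` be the number of roots of `t² - kt + k`. The strata `b = 0`, then `a = 0`,
-- then `b = k`, and the rest have `p`, `p - 1`, `n(p - 1)` and `p(p - 2) - (p - 2 - n)` points, in
-- all `p² + 1 + (n - 1)p`. The three totals of the theorem are `n = 0, 1, 2`, with `n = 1` only at
-- `k = 4`. For `k = 0` the conditions `b ≠ 0` and `b ≠ k` coincide, so `b` takes `p - 1` values in
-- the last stratum, the third is empty, and the sum is again `p² + 1`.

open import Algebra using (CommutativeRing; Op₁; Op₂)
import Algebra.Properties.Ring
import Algebra.Properties.Semiring.Mult
import Algebra.Solver.Ring
open import Algebra.Solver.Ring.AlmostCommutativeRing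
  using (fromCommutativeRing; _-Raw-AlmostCommutative⟶_)
open import Algebra.Structures using (IsCommutativeRing)
open import Data.Integer as ℤ using (ℤ; +_; -[1+_]; +[1+_]; _⊖_)
import Data.Integer.Properties as ℤ
open import Data.Maybe using (Maybe; just; nothing)
open import Data.Nat using (ℕ; zero; suc; s≤s; z≤n)
import Data.Nat as ℕ
import Data.Nat.Properties as ℕ
import Relation.Binary.PropositionalEquality as ≡
open import Relation.Nullary using (¬_; Dec; yes; no; ¬?; toSum)

-- A ring solver with integer coefficients

module IntegerSolver {c ℓ} (R : CommutativeRing c ℓ) where
  open CommutativeRing R
  open Algebra.Properties.Ring ring
  open Algebra.Properties.Semiring.Mult semiring using (×1-homo-*; ×-homo-+) renaming (_×_ to _×ᴿ_)
  open import Relation.Binary.Reasoning.Setoid setoid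
  open import Algebra.Properties.AbelianGroup +-abelianGroup using (⁻¹-∙-comm)

  fromℕ : ℕ → Carrier
  fromℕ n = n ×ᴿ 1#

  fromℤ : ℤ → Carrier
  fromℤ (+ n)    = fromℕ n
  fromℤ -[1+ n ] = - fromℕ (suc n)

  fromℤ-neg : ∀ i → fromℤ (ℤ.- i) ≈ - fromℤ i
  fromℤ-neg (+ zero)  = sym -0#≈0#
  fromℤ-neg +[1+ n ]  = refl
  fromℤ-neg -[1+ n ]  = sym (-‿involutive _)

  fromℤ-⊖ : ∀ m n → fromℤ (m ⊖ n) ≈ fromℕ m - fromℕ n
  fromℤ-⊖ m zero = begin
    fromℕ m          ≈⟨ +-identityʳ _ ⟨
    fromℕ m + 0#     ≈⟨ +-congˡ -0#≈0# ⟨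
    fromℕ m - 0#     ∎
  fromℤ-⊖ zero (suc n) = sym (+-identityˡ _)
  fromℤ-⊖ (suc m) (suc n) = begin
    fromℤ (suc m ⊖ suc n)                    ≡⟨ ≡.cong fromℤ (ℤ.[1+m]⊖[1+n]≡m⊖n m n) ⟩
    fromℤ (m ⊖ n)                            ≈⟨ fromℤ-⊖ m n ⟩
    fromℕ m - fromℕ n                        ≈⟨ +-congʳ (+-identityˡ _) ⟨
    -- Inserting `1# - 1#` restores the successor on both sides; the remaining steps only rearrange.
    0# + fromℕ m - fromℕ n                   ≈⟨ +-congʳ (+-congʳ (-‿inverseʳ 1#)) ⟨
    1# - 1# + fromℕ m - fromℕ n              ≈⟨ +-congʳ (+-assoc _ _ _) ⟩
    1# + (- 1# + fromℕ m) - fromℕ n          ≈⟨ +-congʳ (+-congˡ (+-comm _ _)) ⟩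
    1# + (fromℕ m - 1#) - fromℕ n            ≈⟨ +-congʳ (+-assoc _ _ _) ⟨
    1# + fromℕ m - 1# - fromℕ n              ≈⟨ +-assoc _ _ _ ⟩
    1# + fromℕ m + (- 1# - fromℕ n)          ≈⟨ +-congˡ (⁻¹-∙-comm _ _) ⟩
    fromℕ (suc m) - fromℕ (suc n)            ∎

  fromℤ-+ : ∀ i j → fromℤ (i ℤ.+ j) ≈ fromℤ i + fromℤ j
  fromℤ-+ (+ m)    (+ n)    = ×-homo-+ 1# m n
  fromℤ-+ (+ m)    -[1+ n ] = fromℤ-⊖ m (suc n)
  fromℤ-+ -[1+ m ] (+ n)    = trans (fromℤ-⊖ n (suc m)) (+-comm _ _)
  fromℤ-+ -[1+ m ] -[1+ n ] = begin
    - fromℕ (suc (suc (m ℕ.+ n)))        ≡⟨ ≡.cong (λ k → - fromℕ (suc k)) (≡.sym (ℕ+-suc m n)) ⟩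
    - fromℕ (suc m ℕ.+ suc n)            ≈⟨ -‿cong (×-homo-+ 1# (suc m) (suc n)) ⟩
    - (fromℕ (suc m) + fromℕ (suc n))    ≈⟨ ⁻¹-∙-comm _ _ ⟨
    - fromℕ (suc m) - fromℕ (suc n)      ∎
    where open import Data.Nat.Properties using () renaming (+-suc to ℕ+-suc)

  -- A nonnegative left factor is treated first; a negative one then only contributes a sign that is
  -- pulled out of the product.
  fromℤ-+* : ∀ m j → fromℤ (+ m ℤ.* j) ≈ fromℕ m * fromℤ j
  fromℤ-+* m (+ n) = begin
    fromℤ (+ m ℤ.* + n)      ≡⟨ ≡.cong fromℤ (ℤ.pos-* m n) ⟨
    fromℕ (m ℕ.* n)          ≈⟨ ×1-homo-* m n ⟩
    fromℕ m * fromℕ n        ∎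
  fromℤ-+* m -[1+ n ] = begin
    fromℤ (+ m ℤ.* -[1+ n ])         ≡⟨ ≡.cong fromℤ (ℤ.neg-distribʳ-* (+ m) +[1+ n ]) ⟨
    fromℤ (ℤ.- (+ m ℤ.* +[1+ n ]))   ≈⟨ fromℤ-neg (+ m ℤ.* +[1+ n ]) ⟩
    - fromℤ (+ m ℤ.* +[1+ n ])       ≈⟨ -‿cong (fromℤ-+* m +[1+ n ]) ⟩
    - (fromℕ m * fromℕ (suc n))      ≈⟨ -‿distribʳ-* _ _ ⟩
    fromℕ m * - fromℕ (suc n)        ∎

  fromℤ-* : ∀ i j → fromℤ (i ℤ.* j) ≈ fromℤ i * fromℤ j
  fromℤ-* (+ m)    j = fromℤ-+* m j
  fromℤ-* -[1+ m ] j = begin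
    fromℤ (-[1+ m ] ℤ.* j)           ≡⟨ ≡.cong fromℤ (ℤ.neg-distribˡ-* +[1+ m ] j) ⟨
    fromℤ (ℤ.- (+[1+ m ] ℤ.* j))     ≈⟨ fromℤ-neg (+[1+ m ] ℤ.* j) ⟩
    - fromℤ (+[1+ m ] ℤ.* j)         ≈⟨ -‿cong (fromℤ-+* (suc m) j) ⟩
    - (fromℕ (suc m) * fromℤ j)      ≈⟨ -‿distribˡ-* _ _ ⟩
    - fromℕ (suc m) * fromℤ j        ∎

  fromℤ-homomorphism : ℤ.+-*-rawRing -Raw-AlmostCommutative⟶ fromCommutativeRing R
  fromℤ-homomorphism = record
    { ⟦_⟧    = fromℤ
    ; +-homo = fromℤ-+
    ; *-homo = fromℤ-*
    ; -‿homo = fromℤ-neg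
    ; 0-homo = refl
    ; 1-homo = +-identityʳ 1#
    }

  -- Only a positive answer carries information: distinct integers may still have equal images in
  -- `R`.
  fromℤ-≟ : ∀ i j → Maybe (fromℤ i ≈ fromℤ j)
  fromℤ-≟ i j with i ℤ.≟ j
  ... | yes i≡j = just (reflexive (≡.cong fromℤ i≡j))
  ... | no  _   = nothing

  open Algebra.Solver.Ring ℤ.+-*-rawRing (fromCommutativeRing R) fromℤ-homomorphism fromℤ-≟ public
    using (Polynomial; solve; con; _:=_; _:+_; _:*_; _:-_; :-_)

open import Data.Empty using (⊥-elim)
open import Data.List using (List; []; _∷_; _++_; length; map; filter; allFin; cartesianProduct)
open import Data.List.Membership.Propositional using (_∈_)
open import Data.List.Membership.Propositional.Properties
open import Data.List.Membership.Propositional.Properties.WithK using (unique∧set⇒bag)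
open import Data.List.Properties using (length-++; length-map; length-tabulate)
open import Data.List.Relation.Binary.BagAndSetEquality using (∼bag⇒↭)
open import Data.List.Relation.Binary.Permutation.Propositional.Properties using (↭-length)
open import Data.List.Relation.Unary.All as All using ([]; _∷_)
open import Data.List.Relation.Unary.AllPairs using ([]; _∷_)
open import Data.List.Relation.Unary.Any using (here; there)
open import Data.List.Relation.Unary.Unique.Propositional using (Unique)
import Data.List.Relation.Unary.Unique.Propositional.Properties as Unique
open import Data.Nat.Solver using (module +-*-Solver)
open import Data.Product using (_×_; _,_; proj₁; proj₂; ∃)
open import Data.Sum using (_⊎_; inj₁; inj₂; [_,_]′)
open import Data.Unit using (⊤; tt)
open import Function using (_∘_; id; case_of_)
open import Function.Bundles using (mk⇔)
open import Relation.Binary.Definitions using (DecidableEquality)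
open import Relation.Binary.PropositionalEquality
open import Relation.Unary using (Decidable; _∪_; _∩_; ∁)

-- Sizes of finite predicates

-- A duplicate-free enumeration, because the counts in the theorem are lengths of filtered lists,
-- which have this form already.
record HasSize {A : Set} (P : A → Set) (n : ℕ) : Set where
  field
    elements : List A
    unique   : Unique elements
    sound    : ∀ {x} → x ∈ elements → P x
    complete : ∀ {x} → P x → x ∈ elements
    size     : length elements ≡ n

open HasSize

private variable
  A B : Set
  P Q : A → Set
  m n : ℕ

-- Duplicate-free lists with the same members are permutations of each other. Counting one predicate
-- in two ways thus gives an equation of numbers, which is how every count of the theorem is
-- obtained.
hasSize-unique : HasSize P m → HasSize P n → m ≡ n
hasSize-unique s t = begin
  _                    ≡⟨ size s ⟨
  length (elements s)  ≡⟨ ↭-length (∼bag⇒↭ (unique∧set⇒bag (unique s) (unique t)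
                            (mk⇔ (complete t ∘ sound s) (complete s ∘ sound t)))) ⟩
  length (elements t)  ≡⟨ size t ⟩
  _                    ∎
  where open ≡-Reasoning

hasSize-cong : (∀ {x} → P x → Q x) → (∀ {x} → Q x → P x) → HasSize P n → HasSize Q n
hasSize-cong P⇒Q Q⇒P s = record
  { elements = elements s
  ; unique   = unique s
  ; sound    = P⇒Q ∘ sound s
  ; complete = complete s ∘ Q⇒P
  ; size     = size s
  }

-- Injectivity is asked only on the list, since the maps used below are invertible only on the
-- predicate that is counted.
map-unique : (f : A → B) {xs : List A} →
             (∀ {x y} → x ∈ xs → y ∈ xs → f x ≡ f y → x ≡ y) →
             Unique xs → Unique (map f xs)
map-unique f inj []         = []
map-unique f inj (x∉ ∷ uxs) =
  All.tabulate (λ z∈ fx≡z → let (y , y∈ , z≡fy) = ∈-map⁻ f z∈ in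
    All.lookup x∉ y∈ (inj (here refl) (there y∈) (trans fx≡z z≡fy)))
  ∷ map-unique f (λ x∈ y∈ → inj (there x∈) (there y∈)) uxs

hasSize-bij : {P : A → Set} {Q : B → Set} (f : A → B) (g : B → A) →
              (∀ {x} → P x → Q (f x)) → (∀ {y} → Q y → P (g y)) →
              (∀ {x} → P x → g (f x) ≡ x) → (∀ {y} → Q y → f (g y) ≡ y) →
              HasSize P n → HasSize Q n
hasSize-bij {Q = Q} f g P⇒Q Q⇒P gf fg s = record
  { elements = map f (elements s)
  ; unique   = map-unique f (λ x∈ y∈ eq →
                 trans (sym (gf (sound s x∈))) (trans (cong g eq) (gf (sound s y∈))))
                 (unique s)
  ; sound    = λ y∈ → let (x , x∈ , eq) = ∈-map⁻ f y∈ in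
                 subst Q (sym eq) (P⇒Q (sound s x∈))
  ; complete = λ q → subst (_∈ _) (fg q) (∈-map⁺ f (complete s (Q⇒P q)))
  ; size     = trans (length-map f (elements s)) (size s)
  }

hasSize-∅ : (∀ {x} → ¬ P x) → HasSize P 0
hasSize-∅ ¬P = record
  { elements = [] ; unique = [] ; sound = λ () ; complete = ⊥-elim ∘ ¬P ; size = refl }

hasSize-singleton : (a : A) → HasSize (_≡ a) 1
hasSize-singleton a = record
  { elements = a ∷ []
  ; unique   = [] ∷ []
  ; sound    = λ { (here eq) → eq }
  ; complete = here
  ; size     = refl
  }

hasSize-∪ : (∀ {x} → P x → ¬ Q x) → HasSize P m → HasSize Q n → HasSize (P ∪ Q) (m ℕ.+ n)
hasSize-∪ disjoint s t = record
  { elements = elements s ++ elements t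
  ; unique   = Unique.++⁺ (unique s) (unique t)
                 (λ { (x∈ , y∈) → disjoint (sound s x∈) (sound t y∈) })
  ; sound    = λ x∈ → [ inj₁ ∘ sound s , inj₂ ∘ sound t ]′ (∈-++⁻ (elements s) x∈)
  ; complete = [ ∈-++⁺ˡ ∘ complete s , ∈-++⁺ʳ (elements s) ∘ complete t ]′
  ; size     = trans (length-++ (elements s)) (cong₂ ℕ._+_ (size s) (size t))
  }

length-cartesianProduct : (xs : List A) (ys : List B) →
                          length (cartesianProduct xs ys) ≡ length xs ℕ.* length ys
length-cartesianProduct []       ys = refl
length-cartesianProduct (x ∷ xs) ys = trans (length-++ (map (x ,_) ys))
  (cong₂ ℕ._+_ (length-map (x ,_) ys) (length-cartesianProduct xs ys))

hasSize-× : {P : A → Set} {Q : B → Set} → HasSize P m → HasSize Q n →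
            HasSize (λ (x , y) → P x × Q y) (m ℕ.* n)
hasSize-× s t = record
  { elements = cartesianProduct (elements s) (elements t)
  ; unique   = Unique.cartesianProduct⁺ (unique s) (unique t)
  ; sound    = λ xy∈ → let (x∈ , y∈) = ∈-cartesianProduct⁻ (elements s) (elements t) xy∈ in
                 sound s x∈ , sound t y∈
  ; complete = λ (p , q) → ∈-cartesianProduct⁺ (complete s p) (complete t q)
  ; size     = trans (length-cartesianProduct (elements s) (elements t))
                 (cong₂ ℕ._*_ (size s) (size t))
  }

hasSize-filter : (Q? : Decidable Q) (s : HasSize P n) →
                 HasSize (P ∩ Q) (length (filter Q? (elements s)))
hasSize-filter Q? s = record
  { elements = filter Q? (elements s)
  ; unique   = Unique.filter⁺ Q? (unique s)
  ; sound    = λ x∈ → let (x∈s , q) = ∈-filter⁻ Q? x∈ in sound s x∈s , q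
  ; complete = λ (p , q) → ∈-filter⁺ Q? (complete s p) q
  ; size     = refl
  }

hasSize-split : Decidable Q → HasSize (P ∩ Q) m → HasSize (P ∩ ∁ Q) n → HasSize P (m ℕ.+ n)
hasSize-split Q? s t = hasSize-cong
  [ proj₁ , proj₁ ]′
  (λ {x} p → [ (λ q → inj₁ (p , q)) , (λ ¬q → inj₂ (p , ¬q)) ]′ (toSum (Q? x)))
  (hasSize-∪ (λ (_ , q) (_ , ¬q) → ¬q q) s t)

-- Filtering gives the complement some size; cancelling `m` from the two sizes of `P` identifies it
-- as `n`, without truncated subtraction.
hasSize-∖ : Decidable Q → HasSize P (m ℕ.+ n) → HasSize (P ∩ Q) m → HasSize (P ∩ ∁ Q) n
hasSize-∖ {Q = Q} {P = P} {m = m} Q? s t =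
  subst (HasSize (P ∩ ∁ Q))
    (ℕ.+-cancelˡ-≡ m _ _ (hasSize-unique (hasSize-split Q? t rest) s)) rest
  where rest = hasSize-filter (¬? ∘ Q?) s

hasSize-remove : DecidableEquality A → {P : A → Set} {a : A} → P a →
                 HasSize P (suc n) → HasSize (P ∩ (_≢ a)) n
hasSize-remove _≟_ {P} {a} Pa s =
  hasSize-∖ (_≟ a) s (hasSize-cong (λ { refl → Pa , refl }) proj₂ (hasSize-singleton a))

-- Fields of characteristic other than 2

record OddField : Set₁ where
  infix  8 -_
  infixl 7 _*_
  infixl 6 _+_
  field
    F                 : Set
    _+_ _*_           : Op₂ F
    -_                : Op₁ F
    0# 1#             : F
    isCommutativeRing : IsCommutativeRing _≡_ _+_ _*_ -_ 0# 1#
    _≟_               : DecidableEquality F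
    inv               : F → F
    *-inverseʳ        : ∀ {x} → x ≢ 0# → x * inv x ≡ 1#
    -- Written as `fromℕ 2` unfolds, so that it applies to the solver's constant 2.
    2≢0               : 1# + (1# + 0#) ≢ 0#
    1≢0               : 1# ≢ 0#

module FieldArithmetic (K : OddField) where
  open OddField K public

  commutativeRing : CommutativeRing _ _
  commutativeRing = record { isCommutativeRing = isCommutativeRing }

  open IsCommutativeRing isCommutativeRing public
    using (_-_; *-comm; zeroˡ; zeroʳ; +-identityʳ)
  open IntegerSolver commutativeRing public

  -- fromℕ 1 is 1# + 0#, the value of the solver's constant 1.
  inverseʳ : ∀ {x} → x ≢ 0# → x * inv x ≡ fromℕ 1
  inverseʳ x≢0 = trans (*-inverseʳ x≢0) (sym (+-identityʳ 1#))

  infixl 7 _/_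

  _/_ : F → F → F
  x / y = x * inv y

  κ : ∀ {n} → ℕ → Polynomial n
  κ m = con (+ m)

  x-y≡0⇒x≡y : ∀ {x y} → x - y ≡ 0# → x ≡ y
  x-y≡0⇒x≡y {x} {y} x-y≡0 = begin
    x               ≡⟨ solve 2 (λ x y → x := (x :- y) :+ y) refl x y ⟩
    (x - y) + y     ≡⟨ cong (_+ y) x-y≡0 ⟩
    0# + y          ≡⟨ solve 1 (λ y → κ 0 :+ y := y) refl y ⟩
    y               ∎
    where open ≡-Reasoning

  -- The combine lemmas deduce an equation from given ones by exhibiting it as
  -- a linear combination, which is then a polynomial identity.
  combine₁ : ∀ {l r a b} c → a ≡ b → l - r ≡ c * (a - b) → l ≡ r
  combine₁ {a = a} c refl eq =
    x-y≡0⇒x≡y (trans eq (solve 2 (λ a c → c :* (a :- a) := κ 0) refl a c))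

  combine₂ : ∀ {l r a₁ b₁ a₂ b₂} c₁ c₂ → a₁ ≡ b₁ → a₂ ≡ b₂ →
             l - r ≡ (c₁ * (a₁ - b₁)) + (c₂ * (a₂ - b₂)) → l ≡ r
  combine₂ {a₁ = a₁} {a₂ = a₂} c₁ c₂ refl refl eq =
    x-y≡0⇒x≡y (trans eq (solve 4
      (λ a₁ a₂ c₁ c₂ → c₁ :* (a₁ :- a₁) :+ c₂ :* (a₂ :- a₂) := κ 0) refl a₁ a₂ c₁ c₂))

  combine₃ : ∀ {l r a₁ b₁ a₂ b₂ a₃ b₃} c₁ c₂ c₃ → a₁ ≡ b₁ → a₂ ≡ b₂ → a₃ ≡ b₃ →
             l - r ≡ ((c₁ * (a₁ - b₁)) + (c₂ * (a₂ - b₂))) + (c₃ * (a₃ - b₃)) → l ≡ r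
  combine₃ {a₁ = a₁} {a₂ = a₂} {a₃ = a₃} c₁ c₂ c₃ refl refl refl eq =
    x-y≡0⇒x≡y (trans eq (solve 6
      (λ a₁ a₂ a₃ c₁ c₂ c₃ →
         c₁ :* (a₁ :- a₁) :+ c₂ :* (a₂ :- a₂) :+ c₃ :* (a₃ :- a₃) := κ 0)
      refl a₁ a₂ a₃ c₁ c₂ c₃))

  div-* : ∀ {x y} → y ≢ 0# → (x / y) * y ≡ x
  div-* {x} {y} y≢0 = combine₁ x (inverseʳ y≢0)
    (solve 3 (λ x y i → x :* i :* y :- x := x :* (y :* i :- κ 1)) refl x y (inv y))

  div-unique : ∀ {x y z} → y ≢ 0# → z * y ≡ x → x / y ≡ z
  div-unique {x} {y} {z} y≢0 zy≡x = combine₂ (- inv y) z zy≡x (inverseʳ y≢0)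
    (solve 4 (λ x y z i → x :* i :- z :=
      (:- i) :* (z :* y :- x) :+ z :* (y :* i :- κ 1)) refl x y z (inv y))

  cancel : ∀ {x y} → x ≢ 0# → x * y ≡ 0# → y ≡ 0#
  cancel {x} {y} x≢0 xy≡0 = combine₂ (inv x) (- y) xy≡0 (inverseʳ x≢0)
    (solve 3 (λ x y i → y :- κ 0 :=
      i :* (x :* y :- κ 0) :+ (:- y) :* (x :* i :- κ 1)) refl x y (inv x))

  zero-product : ∀ {x y} → x * y ≡ 0# → x ≡ 0# ⊎ y ≡ 0#
  zero-product {x} xy≡0 with x ≟ 0#
  ... | yes x≡0 = inj₁ x≡0
  ... | no  x≢0 = inj₂ (cancel x≢0 xy≡0)

  square-zero : ∀ {x} → x * x ≡ 0# → x ≡ 0#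
  square-zero xx≡0 = [ id , id ]′ (zero-product xx≡0)

  *≢0 : ∀ {x y} → x ≢ 0# → y ≢ 0# → x * y ≢ 0#
  *≢0 x≢0 y≢0 xy≡0 = y≢0 (cancel x≢0 xy≡0)

  1ᶠ 4# : F
  1ᶠ = fromℕ 1
  4# = fromℕ 4

  4≢0 : 4# ≢ 0#
  4≢0 4≡0 = *≢0 2≢0 2≢0 (trans (solve 0 (κ 2 :* κ 2 := κ 4) refl) 4≡0)

  x≢y⇒x-y≢0 : ∀ {x y} → x ≢ y → x - y ≢ 0#
  x≢y⇒x-y≢0 x≢y = x≢y ∘ x-y≡0⇒x≡y

  double-zero : ∀ {x} → x + x ≡ 0# → x ≡ 0#
  double-zero {x} x+x≡0 = cancel 2≢0
    (trans (solve 1 (λ x → κ 2 :* x := x :+ x) refl x) x+x≡0)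

-- The surface s² = abc with s = a + b + c - k

module Surface (K : OddField) (k : OddField.F K) where
  open FieldArithmetic K

  Point : Set
  Point = F × F × F

  s : Point → F
  s (a , b , c) = a + b + c - k

  -- The products are in cyclic order `b * c`, `c * a`, `a * b`, so that rotating the coordinates
  -- permutes the three conditions without appeal to commutativity.
  OnSurface FixedA FixedB FixedC : Point → Set
  OnSurface v@(a , b , c) = s v * s v ≡ a * b * c
  FixedA v@(a , b , c) = s v + s v ≡ b * c
  FixedB v@(a , b , c) = s v + s v ≡ c * a
  FixedC v@(a , b , c) = s v + s v ≡ a * b

  -- Squaring `2s = bc` and using `s² = abc` gives `(bc)² = 4abc`; cancelling `bc` leaves `bc = 4a`,
  -- whence `2s = 4a`. Here `s` is a free variable, so the lemma also applies with the coordinates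
  -- permuted.
  fixed-product : ∀ {s a b c} → s * s ≡ a * b * c → s + s ≡ b * c → b ≢ 0# → c ≢ 0# →
                  b * c ≡ 4# * a × s ≡ a + a
  fixed-product {s} {a} {b} {c} ss≡abc 2s≡bc b≢0 c≢0 = bc≡4a , s≡2a
    where
    bc≡4a : b * c ≡ 4# * a
    bc≡4a = x-y≡0⇒x≡y (cancel (*≢0 b≢0 c≢0)
      (combine₂ (- (b * c + (s + s))) 4# 2s≡bc ss≡abc (solve 4 (λ s a b c →
        b :* c :* (b :* c :- κ 4 :* a) :- κ 0 :=
        (:- (b :* c :+ (s :+ s))) :* (s :+ s :- b :* c) :+ κ 4 :* (s :* s :- a :* b :* c))
        refl s a b c)))

    s≡2a : s ≡ a + a
    s≡2a = x-y≡0⇒x≡y (double-zero (combine₂ 1ᶠ 1ᶠ 2s≡bc bc≡4a (solve 4 (λ s a b c →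
        (s :- (a :+ a)) :+ (s :- (a :+ a)) :- κ 0 :=
        κ 1 :* (s :+ s :- b :* c) :+ κ 1 :* (b :* c :- κ 4 :* a)) refl s a b c)))

  -- Points with a trivial flip, up to rotation of the coordinates

  FixedOnlyA MovedOnlyA FixedAll : Point → Set
  FixedOnlyA v = OnSurface v × FixedA v × ¬ FixedB v × ¬ FixedC v
  MovedOnlyA v = OnSurface v × ¬ FixedA v × FixedB v × FixedC v
  FixedAll   v = OnSurface v × FixedA v × FixedB v × FixedC v

  -- Away from abc = 0 the condition FixedA on the surface says 4a = bc and s = 2a.
  module _ {a b c : F} (fixedOnlyA : FixedOnlyA (a , b , c)) where
    private
      t = s (a , b , c)
      on : t * t ≡ a * b * c
      on = proj₁ fixedOnlyA
      fA : t + t ≡ b * c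
      fA = proj₁ (proj₂ fixedOnlyA)
      nB : ¬ (t + t ≡ c * a)
      nB = proj₁ (proj₂ (proj₂ fixedOnlyA))
      nC : ¬ (t + t ≡ a * b)
      nC = proj₂ (proj₂ (proj₂ fixedOnlyA))

    -- If `b` vanished, `b * c` and `a * b` would both be zero and the third flip would be trivial
    -- along with the first.
    fixedOnlyA⇒b≢0 : b ≢ 0#
    fixedOnlyA⇒b≢0 b≡0 = nC (combine₂ 1ᶠ (c - a) fA b≡0 (solve 4 (λ t a b c →
      (t :+ t) :- a :* b := κ 1 :* (t :+ t :- b :* c) :+ (c :- a) :* (b :- κ 0)) refl t a b c))

    fixedOnlyA⇒c≢0 : c ≢ 0#
    fixedOnlyA⇒c≢0 c≡0 = nB (combine₂ 1ᶠ (b - a) fA c≡0 (solve 4 (λ t a b c →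
      (t :+ t) :- c :* a := κ 1 :* (t :+ t :- b :* c) :+ (b :- a) :* (c :- κ 0)) refl t a b c))

    private
      bc≡4a = proj₁ (fixed-product on fA fixedOnlyA⇒b≢0 fixedOnlyA⇒c≢0)
      t≡2a  = proj₂ (fixed-product on fA fixedOnlyA⇒b≢0 fixedOnlyA⇒c≢0)

    -- For `b ≡ 4#` the products `a * b` and `b * c` both equal `4a`, so again the third flip would
    -- be trivial.
    fixedOnlyA⇒b≢4 : b ≢ 4#
    fixedOnlyA⇒b≢4 b≡4 = nC (combine₃ 1ᶠ 1ᶠ (- a) fA bc≡4a b≡4 (solve 4 (λ t a b c →
      (t :+ t) :- a :* b :=
      κ 1 :* (t :+ t :- b :* c) :+ κ 1 :* (b :* c :- κ 4 :* a) :+ (:- a) :* (b :- κ 4))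
      refl t a b c))

    fixedOnlyA⇒c≢4 : c ≢ 4#
    fixedOnlyA⇒c≢4 c≡4 = nB (combine₃ 1ᶠ 1ᶠ (- a) fA bc≡4a c≡4 (solve 4 (λ t a b c →
      (t :+ t) :- c :* a :=
      κ 1 :* (t :+ t :- b :* c) :+ κ 1 :* (b :* c :- κ 4 :* a) :+ (:- a) :* (c :- κ 4))
      refl t a b c))

    fixedOnlyA⇒a≡b+c-k : a ≡ b + c - k
    fixedOnlyA⇒a≡b+c-k = combine₁ (- 1ᶠ) t≡2a (solve 4 (λ a b c k →
      a :- (b :+ c :- k) := (:- κ 1) :* (a :+ b :+ c :- k :- (a :+ a))) refl a b c k)

    -- The hyperbola `(b - 4)(c - 4) = 4(4 - k)` in the form solved for `c`, which exhibits `c` as a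
    -- function of `b`.
    fixedOnlyA⇒[b-4]c≡4[b-k] : c * (b - 4#) ≡ 4# * (b - k)
    fixedOnlyA⇒[b-4]c≡4[b-k] = combine₂ 1ᶠ 4# bc≡4a fixedOnlyA⇒a≡b+c-k (solve 4 (λ a b c k →
      c :* (b :- κ 4) :- κ 4 :* (b :- k) :=
      κ 1 :* (b :* c :- κ 4 :* a) :+ κ 4 :* (a :- (b :+ c :- k))) refl a b c k)

    fixedOnlyA⇒b≢k : b ≢ k
    fixedOnlyA⇒b≢k b≡k = *≢0 fixedOnlyA⇒c≢0 (x≢y⇒x-y≢0 fixedOnlyA⇒b≢4)
      (combine₂ 1ᶠ 4# fixedOnlyA⇒[b-4]c≡4[b-k] b≡k (solve 3 (λ b c k →
        c :* (b :- κ 4) :- κ 0 :=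
        κ 1 :* (c :* (b :- κ 4) :- κ 4 :* (b :- k)) :+ κ 4 :* (b :- k)) refl b c k))

    -- For `k ≡ 4#` the hyperbola degenerates to the lines `b = 4` and `c = 4`, both already
    -- excluded.
    fixedOnlyA⇒k≢4 : k ≢ 4#
    fixedOnlyA⇒k≢4 k≡4 = *≢0 (x≢y⇒x-y≢0 fixedOnlyA⇒c≢4) (x≢y⇒x-y≢0 fixedOnlyA⇒b≢4)
      (combine₂ 1ᶠ (- 4#) fixedOnlyA⇒[b-4]c≡4[b-k] k≡4 (solve 3 (λ b c k →
        (c :- κ 4) :* (b :- κ 4) :- κ 0 :=
        κ 1 :* (c :* (b :- κ 4) :- κ 4 :* (b :- k)) :+ (:- κ 4) :* (k :- κ 4)) refl b c k))

  -- Since `s = 2a` with `a` nonzero, a trivial second or third flip would say `c = 4` or `b = 4`.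
  -- The conditions on `b` and `k` keep `a` and `c - 4` away from zero: `c = 0` would give `b = k`,
  -- and `c = 4` would give `k = 4`.
  [b-4]c≡4[b-k]⇒fixedOnlyA : ∀ {b c} → k ≢ 4# → b ≢ 0# → b ≢ k → b ≢ 4# →
    c * (b - 4#) ≡ 4# * (b - k) → FixedOnlyA (b + c - k , b , c)
  [b-4]c≡4[b-k]⇒fixedOnlyA {b} {c} k≢4 b≢0 b≢k b≢4 eq = on , fA , nB , nC
    where
    a = b + c - k
    t = s (a , b , c)

    bc≡4a : b * c ≡ 4# * a
    bc≡4a = combine₁ 1ᶠ eq (solve 3 (λ b c k →
      b :* c :- κ 4 :* (b :+ c :- k) :=
      κ 1 :* (c :* (b :- κ 4) :- κ 4 :* (b :- k))) refl b c k)

    t≡2a : t ≡ a + a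
    t≡2a = solve 3 (λ b c k →
      (b :+ c :- k) :+ b :+ c :- k := (b :+ c :- k) :+ (b :+ c :- k)) refl b c k

    on : t * t ≡ a * b * c
    on = combine₂ (t + a + a) (- a) t≡2a bc≡4a (solve 4 (λ t a b c →
      t :* t :- a :* b :* c :=
      (t :+ a :+ a) :* (t :- (a :+ a)) :+ (:- a) :* (b :* c :- κ 4 :* a)) refl t a b c)

    fA : t + t ≡ b * c
    fA = combine₂ (fromℕ 2) (- 1ᶠ) t≡2a bc≡4a (solve 4 (λ t a b c →
      t :+ t :- b :* c :=
      κ 2 :* (t :- (a :+ a)) :+ (:- κ 1) :* (b :* c :- κ 4 :* a)) refl t a b c)

    c≢0 : c ≢ 0#
    c≢0 c≡0 = *≢0 4≢0 (x≢y⇒x-y≢0 b≢k) (combine₂ (b - 4#) (- 1ᶠ) c≡0 eq (solve 3 (λ b c k →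
      κ 4 :* (b :- k) :- κ 0 :=
      (b :- κ 4) :* (c :- κ 0) :+ (:- κ 1) :* (c :* (b :- κ 4) :- κ 4 :* (b :- k))) refl b c k))

    a≢0 : a ≢ 0#
    a≢0 a≡0 = *≢0 b≢0 c≢0 (combine₂ 1ᶠ 4# bc≡4a a≡0 (solve 3 (λ a b c →
      b :* c :- κ 0 := κ 1 :* (b :* c :- κ 4 :* a) :+ κ 4 :* (a :- κ 0)) refl a b c))

    c≢4 : c ≢ 4#
    c≢4 c≡4 = *≢0 4≢0 (x≢y⇒x-y≢0 k≢4) (combine₂ 1ᶠ (- (b - 4#)) eq c≡4 (solve 3 (λ b c k →
      κ 4 :* (k :- κ 4) :- κ 0 :=
      κ 1 :* (c :* (b :- κ 4) :- κ 4 :* (b :- k)) :+ (:- (b :- κ 4)) :* (c :- κ 4)) refl b c k))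

    4a≡xa⇒⊥ : ∀ {x} → x ≢ 4# → t + t ≢ x * a
    4a≡xa⇒⊥ {x} x≢4 2t≡xa = *≢0 a≢0 (x≢y⇒x-y≢0 x≢4)
      (combine₂ (- 1ᶠ) (fromℕ 2) 2t≡xa t≡2a (solve 3 (λ t a x →
        a :* (x :- κ 4) :- κ 0 :=
        (:- κ 1) :* (t :+ t :- x :* a) :+ κ 2 :* (t :- (a :+ a))) refl t a x))

    nB : t + t ≢ c * a
    nB = 4a≡xa⇒⊥ c≢4

    nC : t + t ≢ a * b
    nC 2t≡ab = 4a≡xa⇒⊥ b≢4 (trans 2t≡ab (*-comm a b))

  -- The coordinate `b` is the parameter. For `k ≡ 0#` two of its three forbidden values coincide,
  -- which accounts for `p - 2` in place of `p - 3`.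
  fixedOnlyA-size : ∀ {n} → k ≢ 4# → HasSize (λ b → (b ≢ 0# × b ≢ k) × b ≢ 4#) n →
                    HasSize FixedOnlyA n
  fixedOnlyA-size k≢4 = hasSize-bij point (proj₁ ∘ proj₂)
    (λ ((b≢0 , b≢k) , b≢4) →
       [b-4]c≡4[b-k]⇒fixedOnlyA k≢4 b≢0 b≢k b≢4 (div-* (x≢y⇒x-y≢0 b≢4)))
    (λ f → (fixedOnlyA⇒b≢0 f , fixedOnlyA⇒b≢k f) , fixedOnlyA⇒b≢4 f)
    (λ _ → refl)
    (λ { {a , b , c} f →
       let c≡ = div-unique (x≢y⇒x-y≢0 (fixedOnlyA⇒b≢4 f)) (fixedOnlyA⇒[b-4]c≡4[b-k] f)
       in cong₂ (λ a c → a , b , c)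
            (trans (cong (λ c → b + c - k) c≡) (sym (fixedOnlyA⇒a≡b+c-k f))) c≡ })
    where
    point : F → Point
    point b = let c = 4# * (b - k) / (b - 4#) in b + c - k , b , c

  fixedOnlyA-empty : k ≡ 4# → HasSize FixedOnlyA 0
  fixedOnlyA-empty k≡4 = hasSize-∅ (λ f → fixedOnlyA⇒k≢4 f k≡4)

  -- Points moved by exactly one flip

  movedOnlyA-a≡0⇒ : ∀ {b c} → MovedOnlyA (0# , b , c) → (b ≢ 0# × b ≢ k) × c ≡ k - b
  movedOnlyA-a≡0⇒ {b} {c} (on , nA , fB , fC) = (b≢0 , b≢k) , c≡k-b
    where
    t = s (0# , b , c)

    t≡0 : t ≡ 0#
    t≡0 = double-zero (trans fC (zeroˡ b))

    -- As `s` is zero, the first flip moves the point exactly when `b * c` is nonzero.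
    nA′ : b * c ≢ 0#
    nA′ bc≡0 = nA (trans (trans fC (zeroˡ b)) (sym bc≡0))

    c≡k-b : c ≡ k - b
    c≡k-b = combine₁ 1ᶠ t≡0 (solve 3 (λ b c k →
      c :- (k :- b) := κ 1 :* (κ 0 :+ b :+ c :- k :- κ 0)) refl b c k)

    b≢0 : b ≢ 0#
    b≢0 refl = nA′ (zeroˡ c)

    b≢k : b ≢ k
    b≢k refl = nA′ (combine₁ k c≡k-b (solve 2 (λ k c →
      k :* c :- κ 0 := k :* (c :- (k :- k))) refl k c))

  movedOnlyA-a≡0⇐ : ∀ {b} → b ≢ 0# → b ≢ k → MovedOnlyA (0# , b , k - b)
  movedOnlyA-a≡0⇐ {b} b≢0 b≢k = on , nA , fB , fC
    where
    on = solve 2 (λ b k → let t = κ 0 :+ b :+ (k :- b) :- k in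
           t :* t := κ 0 :* b :* (k :- b)) refl b k
    fB = solve 2 (λ b k → let t = κ 0 :+ b :+ (k :- b) :- k in
           t :+ t := (k :- b) :* κ 0) refl b k
    fC = solve 2 (λ b k → let t = κ 0 :+ b :+ (k :- b) :- k in
           t :+ t := κ 0 :* b) refl b k

    nA : ¬ FixedA (0# , b , k - b)
    nA fA = *≢0 b≢0 (x≢y⇒x-y≢0 (b≢k ∘ sym)) (trans (sym fA) (trans fC (zeroˡ b)))

  fixedBC⇒b≡c : ∀ {a b c} → a ≢ 0# → FixedB (a , b , c) → FixedC (a , b , c) → b ≡ c
  fixedBC⇒b≡c {a} {b} {c} a≢0 fB fC = x-y≡0⇒x≡y (cancel a≢0
    (combine₂ 1ᶠ (- 1ᶠ) fB fC (solve 4 (λ t a b c →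
      a :* (b :- c) :- κ 0 :=
      κ 1 :* (t :+ t :- c :* a) :+ (:- κ 1) :* (t :+ t :- a :* b)) refl (s (a , b , c)) a b c)))

  -- This is `fixed-product` for the third flip: `a * b ≡ 4# * b` yields `a ≡ 4#`, and `s ≡ b + b`
  -- then leaves `a ≡ k`.
  fixedBC⇒a≡4∧k≡4 : ∀ {a b} → a ≢ 0# → b ≢ 0# → OnSurface (a , b , b) → FixedC (a , b , b) →
                    a ≡ 4# × k ≡ 4#
  fixedBC⇒a≡4∧k≡4 {a} {b} a≢0 b≢0 on fC = a≡4 , k≡4
    where
    t = s (a , b , b)
    both : a * b ≡ 4# * b × t ≡ b + b
    both = fixed-product (trans on (solve 2 (λ a b → a :* b :* b := b :* a :* b) refl a b))
             fC a≢0 b≢0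

    a≡4 : a ≡ 4#
    a≡4 = x-y≡0⇒x≡y (cancel b≢0 (combine₁ 1ᶠ (proj₁ both) (solve 2 (λ a b →
      b :* (a :- κ 4) :- κ 0 := κ 1 :* (a :* b :- κ 4 :* b)) refl a b)))

    k≡4 : k ≡ 4#
    k≡4 = combine₂ 1ᶠ (- 1ᶠ) a≡4 (proj₂ both) (solve 3 (λ a b k →
      k :- κ 4 := κ 1 :* (a :- κ 4) :+ (:- κ 1) :* (a :+ b :+ b :- k :- (b :+ b))) refl a b k)

  movedOnlyA-a≢0⇒ : ∀ {a b c} → a ≢ 0# → MovedOnlyA (a , b , c) →
                    k ≡ 4# × (a ≡ 4# × b ≡ c) × (b ≢ 0# × b ≢ 4#)
  movedOnlyA-a≢0⇒ {a} {b} {c} a≢0 (on , nA , fB , fC)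
    with refl ← fixedBC⇒b≡c {a} {b} {c} a≢0 fB fC =
    k≡4 , (a≡4 , refl) , b≢0 , λ b≡4 → nA (trans fC (cong (_* b) (trans a≡4 (sym b≡4))))
    where
    b≢0 : b ≢ 0#
    b≢0 refl = nA (trans fB (trans (zeroˡ a) (sym (zeroˡ 0#))))

    a≡4 = proj₁ (fixedBC⇒a≡4∧k≡4 a≢0 b≢0 on fC)
    k≡4 = proj₂ (fixedBC⇒a≡4∧k≡4 a≢0 b≢0 on fC)

  s[4,b,b]≡2b : ∀ {b} → k ≡ 4# → s (4# , b , b) ≡ b + b
  s[4,b,b]≡2b {b} refl = solve 1 (λ b → κ 4 :+ b :+ b :- κ 4 := b :+ b) refl b

  onSurface-[4,b,b] : ∀ {b} → k ≡ 4# → OnSurface (4# , b , b)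
  onSurface-[4,b,b] {b} k≡4 = trans (cong (λ t → t * t) (s[4,b,b]≡2b k≡4))
    (solve 1 (λ b → (b :+ b) :* (b :+ b) := κ 4 :* b :* b) refl b)

  fixedC-[4,b,b] : ∀ {b} → k ≡ 4# → FixedC (4# , b , b)
  fixedC-[4,b,b] {b} k≡4 = trans (cong (λ t → t + t) (s[4,b,b]≡2b k≡4))
    (solve 1 (λ b → (b :+ b) :+ (b :+ b) := κ 4 :* b) refl b)

  movedOnlyA-a≢0⇐ : ∀ {b} → k ≡ 4# → b ≢ 0# → b ≢ 4# → MovedOnlyA (4# , b , b)
  movedOnlyA-a≢0⇐ {b} k≡4 b≢0 b≢4 = onSurface-[4,b,b] k≡4 , nA , trans fC (*-comm 4# b) , fC
    where
    fC = fixedC-[4,b,b] k≡4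

    nA : ¬ FixedA (4# , b , b)
    nA fA = *≢0 b≢0 (x≢y⇒x-y≢0 b≢4) (combine₂ (- 1ᶠ) 1ᶠ fA fC (solve 2 (λ t b →
      b :* (b :- κ 4) :- κ 0 :=
      (:- κ 1) :* (t :+ t :- b :* b) :+ κ 1 :* (t :+ t :- κ 4 :* b)) refl (s (4# , b , b)) b))

  movedOnlyA-a≡0-size : ∀ {n} → HasSize (λ b → b ≢ 0# × b ≢ k) n →
                        HasSize (MovedOnlyA ∩ (λ v → proj₁ v ≡ 0#)) n
  movedOnlyA-a≡0-size = hasSize-bij (λ b → 0# , b , k - b) (proj₁ ∘ proj₂)
    (λ (b≢0 , b≢k) → movedOnlyA-a≡0⇐ b≢0 b≢k , refl)
    (λ { (m , refl) → proj₁ (movedOnlyA-a≡0⇒ m) })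
    (λ _ → refl)
    (λ { (m , refl) → cong (λ c → 0# , _ , c) (sym (proj₂ (movedOnlyA-a≡0⇒ m))) })

  a≟0 : Decidable (λ (v : Point) → proj₁ v ≡ 0#)
  a≟0 v = proj₁ v ≟ 0#

  movedOnlyA-size : ∀ {n} → k ≢ 4# → HasSize (λ b → b ≢ 0# × b ≢ k) n → HasSize MovedOnlyA (n ℕ.+ 0)
  movedOnlyA-size k≢4 size = hasSize-split a≟0 (movedOnlyA-a≡0-size size)
    (hasSize-∅ (λ (m , a≢0) → k≢4 (proj₁ (movedOnlyA-a≢0⇒ a≢0 m))))

  -- Two disjoint families, `(0, b, k - b)` and `(4, b, b)`, have the same parameter set when
  -- `k ≡ 4#`; this doubling is the origin of the factor 6 in `6(p - 2)`.
  movedOnlyA-size₄ : ∀ {n} → k ≡ 4# → HasSize (λ b → b ≢ 0# × b ≢ k) n → HasSize MovedOnlyA (n ℕ.+ n)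
  movedOnlyA-size₄ k≡4@refl size = hasSize-split a≟0 (movedOnlyA-a≡0-size size)
    (hasSize-bij (λ b → 4# , b , b) (proj₁ ∘ proj₂)
      (λ (b≢0 , b≢4) → movedOnlyA-a≢0⇐ k≡4 b≢0 b≢4 , 4≢0)
      (λ (m , a≢0) → proj₂ (proj₂ (movedOnlyA-a≢0⇒ a≢0 m)))
      (λ _ → refl)
      (λ (m , a≢0) → let (_ , (a≡4 , b≡c) , _) = movedOnlyA-a≢0⇒ a≢0 m in
        cong₂ (λ a c → a , _ , c) (sym a≡4) b≡c)
      size)

  -- Points fixed by all three flips

  fixedAll⇒ : ∀ {a b c} → FixedAll (a , b , c) →
    (((a , b , c) ≡ (k , 0# , 0#) ⊎ (a , b , c) ≡ (0# , k , 0#)) ⊎ (a , b , c) ≡ (0# , 0# , k))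
    ⊎ (k ≡ 4# × (a , b , c) ≡ (4# , 4# , 4#))
  fixedAll⇒ {a} {b} {c} (on , fA , fB , fC) with a ≟ 0#
  -- With `a` zero also `s` and `b * c` vanish, which leaves two of the axis points.
  ... | yes refl = inj₁ ([ b≡0⇒ , c≡0⇒ ]′ (zero-product (trans (sym fA) 2t≡0)))
    where
    2t≡0 = trans fC (zeroˡ b)
    t≡0 = double-zero 2t≡0

    b≡0⇒ : b ≡ 0# → _
    b≡0⇒ refl = inj₂ (cong (λ c → 0# , 0# , c) (combine₁ 1ᶠ t≡0 (solve 2 (λ c k →
      c :- k := κ 1 :* (κ 0 :+ κ 0 :+ c :- k :- κ 0)) refl c k)))

    c≡0⇒ : c ≡ 0# → _
    c≡0⇒ refl = inj₁ (inj₂ (cong (λ b → 0# , b , 0#) (combine₁ 1ᶠ t≡0 (solve 2 (λ b k →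
      b :- k := κ 1 :* (κ 0 :+ b :+ κ 0 :- k :- κ 0)) refl b k))))
  -- With `a` nonzero the last two flips force `b ≡ c`; zero gives the remaining axis point, and
  -- otherwise `b * b` and `4b` both equal `2s`.
  ... | no a≢0 with refl ← fixedBC⇒b≡c {a} {b} {c} a≢0 fB fC with b ≟ 0#
  ... | yes refl = inj₁ (inj₁ (inj₁ (cong (λ a → a , 0# , 0#) (combine₁ 1ᶠ t≡0 (solve 2 (λ a k →
      a :- k := κ 1 :* (a :+ κ 0 :+ κ 0 :- k :- κ 0)) refl a k)))))
    where t≡0 = double-zero (trans fB (zeroˡ a))
  ... | no b≢0 = inj₂ (k≡4 , cong₂ _,_ a≡4 (cong₂ _,_ b≡4 b≡4))
    where
    a≡4 = proj₁ (fixedBC⇒a≡4∧k≡4 a≢0 b≢0 on fC)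
    k≡4 = proj₂ (fixedBC⇒a≡4∧k≡4 a≢0 b≢0 on fC)

    b≡4 : b ≡ 4#
    b≡4 = x-y≡0⇒x≡y (cancel b≢0 (combine₃ (- 1ᶠ) 1ᶠ b fA fC a≡4 (solve 3 (λ t a b →
      b :* (b :- κ 4) :- κ 0 :=
      (:- κ 1) :* (t :+ t :- b :* b) :+ κ 1 :* (t :+ t :- a :* b) :+ b :* (a :- κ 4))
      refl (s (a , b , b)) a b)))

  fixedAll-[k,0,0] : FixedAll (k , 0# , 0#)
  fixedAll-[k,0,0] =
      solve 1 (λ k → let t = k :+ κ 0 :+ κ 0 :- k in t :* t := k :* κ 0 :* κ 0) refl k
    , solve 1 (λ k → let t = k :+ κ 0 :+ κ 0 :- k in t :+ t := κ 0 :* κ 0) refl k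
    , solve 1 (λ k → let t = k :+ κ 0 :+ κ 0 :- k in t :+ t := κ 0 :* k) refl k
    , solve 1 (λ k → let t = k :+ κ 0 :+ κ 0 :- k in t :+ t := k :* κ 0) refl k

  fixedAll-[0,k,0] : FixedAll (0# , k , 0#)
  fixedAll-[0,k,0] =
      solve 1 (λ k → let t = κ 0 :+ k :+ κ 0 :- k in t :* t := κ 0 :* k :* κ 0) refl k
    , solve 1 (λ k → let t = κ 0 :+ k :+ κ 0 :- k in t :+ t := k :* κ 0) refl k
    , solve 1 (λ k → let t = κ 0 :+ k :+ κ 0 :- k in t :+ t := κ 0 :* κ 0) refl k
    , solve 1 (λ k → let t = κ 0 :+ k :+ κ 0 :- k in t :+ t := κ 0 :* k) refl k

  fixedAll-[0,0,k] : FixedAll (0# , 0# , k)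
  fixedAll-[0,0,k] =
      solve 1 (λ k → let t = κ 0 :+ κ 0 :+ k :- k in t :* t := κ 0 :* κ 0 :* k) refl k
    , solve 1 (λ k → let t = κ 0 :+ κ 0 :+ k :- k in t :+ t := κ 0 :* k) refl k
    , solve 1 (λ k → let t = κ 0 :+ κ 0 :+ k :- k in t :+ t := k :* κ 0) refl k
    , solve 1 (λ k → let t = κ 0 :+ κ 0 :+ k :- k in t :+ t := κ 0 :* κ 0) refl k

  fixedAll-[4,4,4] : k ≡ 4# → FixedAll (4# , 4# , 4#)
  fixedAll-[4,4,4] k≡4 = onSurface-[4,b,b] k≡4 , fC , fC , fC
    where fC = fixedC-[4,b,b] k≡4

  -- The three axis points merge into the origin, and `(4, 4, 4)` would need `0 = 4`.
  fixedAll-size₀ : k ≡ 0# → HasSize FixedAll 1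
  fixedAll-size₀ refl = hasSize-cong (λ { refl → fixedAll-[0,0,k] })
    (λ f → [ [ [ id , id ]′ , id ]′ , (λ (0≡4 , _) → ⊥-elim (4≢0 (sym 0≡4))) ]′ (fixedAll⇒ f))
    (hasSize-singleton (0# , 0# , 0#))

  axis-points-size : k ≢ 0# →
    HasSize (((_≡ (k , 0# , 0#)) ∪ (_≡ (0# , k , 0#))) ∪ (_≡ (0# , 0# , k))) 3
  axis-points-size k≢0 =
    hasSize-∪ (λ { (inj₁ refl) eq → k≢0 (cong proj₁ eq)
                 ; (inj₂ refl) eq → k≢0 (cong (proj₁ ∘ proj₂) eq) })
      (hasSize-∪ (λ { refl eq → k≢0 (cong proj₁ eq) })
        (hasSize-singleton (k , 0# , 0#)) (hasSize-singleton (0# , k , 0#)))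
      (hasSize-singleton (0# , 0# , k))

  axis-points-fixedAll : ∀ {v} →
    (((_≡ (k , 0# , 0#)) ∪ (_≡ (0# , k , 0#))) ∪ (_≡ (0# , 0# , k))) v → FixedAll v
  axis-points-fixedAll (inj₁ (inj₁ refl)) = fixedAll-[k,0,0]
  axis-points-fixedAll (inj₁ (inj₂ refl)) = fixedAll-[0,k,0]
  axis-points-fixedAll (inj₂ refl)        = fixedAll-[0,0,k]

  fixedAll-size : k ≢ 0# → k ≢ 4# → HasSize FixedAll 3
  fixedAll-size k≢0 k≢4 = hasSize-cong axis-points-fixedAll
    (λ f → [ id , (λ (k≡4 , _) → ⊥-elim (k≢4 k≡4)) ]′ (fixedAll⇒ f))
    (axis-points-size k≢0)

  fixedAll-size₄ : k ≡ 4# → HasSize FixedAll 4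
  fixedAll-size₄ k≡4@refl = hasSize-cong
    [ axis-points-fixedAll , (λ { refl → fixedAll-[4,4,4] k≡4 }) ]′
    (λ f → [ inj₁ , inj₂ ∘ proj₂ ]′ (fixedAll⇒ f))
    (hasSize-∪ (λ { (inj₁ (inj₁ eq)) refl → 4≢0 (cong (proj₁ ∘ proj₂) eq)
                  ; (inj₁ (inj₂ eq)) refl → 4≢0 (cong proj₁ eq)
                  ; (inj₂ eq) refl → 4≢0 (cong proj₁ eq) })
      (axis-points-size 4≢0) (hasSize-singleton (4# , 4# , 4#)))

-- Points of the surface by number of moving flips

-- The decided proposition is that a flip is trivial, so a `yes` adds nothing to the degree.
moves : {P : Set} → Dec P → ℕ
moves (yes _) = 0
moves (no  _) = 1

module _ {P Q R : Set} where
  private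
    moves₃ : Dec P → Dec Q → Dec R → ℕ
    moves₃ p q r = moves p ℕ.+ (moves q ℕ.+ moves r)

  moves≡0⇒ : ∀ p q r → moves₃ p q r ≡ 0 → P × Q × R
  moves≡0⇒ (yes p) (yes q) (yes r) _  = p , q , r
  moves≡0⇒ (yes _) (yes _) (no _)  ()
  moves≡0⇒ (yes _) (no _)  _       ()
  moves≡0⇒ (no _)  _       _       ()

  moves≡0⇐ : ∀ p q r → P × Q × R → moves₃ p q r ≡ 0
  moves≡0⇐ (yes _) (yes _) (yes _) _           = refl
  moves≡0⇐ (no ¬p) _       _       (p , _ , _) = ⊥-elim (¬p p)
  moves≡0⇐ (yes _) (no ¬q) _       (_ , q , _) = ⊥-elim (¬q q)
  moves≡0⇐ (yes _) (yes _) (no ¬r) (_ , _ , r) = ⊥-elim (¬r r)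

  moves≡1⇒ : ∀ p q r → moves₃ p q r ≡ 1 →
             (¬ P × Q × R) ⊎ (P × ¬ Q × R) ⊎ (P × Q × ¬ R)
  moves≡1⇒ (yes p) (yes q) (no ¬r) _ = inj₂ (inj₂ (p , q , ¬r))
  moves≡1⇒ (yes p) (no ¬q) (yes r) _ = inj₂ (inj₁ (p , ¬q , r))
  moves≡1⇒ (no ¬p) (yes q) (yes r) _ = inj₁ (¬p , q , r)
  moves≡1⇒ (yes _) (yes _) (yes _) ()
  moves≡1⇒ (yes _) (no _)  (no _)  ()
  moves≡1⇒ (no _)  (yes _) (no _)  ()
  moves≡1⇒ (no _)  (no _)  _       ()

  moves≡1⇐ : ∀ p q r → (¬ P × Q × R) ⊎ (P × ¬ Q × R) ⊎ (P × Q × ¬ R) → moves₃ p q r ≡ 1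
  moves≡1⇐ (yes _) (yes _) (no _)  _ = refl
  moves≡1⇐ (yes _) (no _)  (yes _) _ = refl
  moves≡1⇐ (no _)  (yes _) (yes _) _ = refl
  moves≡1⇐ (yes p) (yes q) (yes r) (inj₁ (¬p , _ , _))        = ⊥-elim (¬p p)
  moves≡1⇐ (yes p) (yes q) (yes r) (inj₂ (inj₁ (_ , ¬q , _))) = ⊥-elim (¬q q)
  moves≡1⇐ (yes p) (yes q) (yes r) (inj₂ (inj₂ (_ , _ , ¬r))) = ⊥-elim (¬r r)
  moves≡1⇐ (no ¬p) _       _       (inj₂ (inj₁ (p , _ , _)))  = ⊥-elim (¬p p)
  moves≡1⇐ (no ¬p) _       _       (inj₂ (inj₂ (p , _ , _)))  = ⊥-elim (¬p p)
  moves≡1⇐ _       (no ¬q) _       (inj₁ (_ , q , _))         = ⊥-elim (¬q q)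
  moves≡1⇐ _       (no ¬q) _       (inj₂ (inj₂ (_ , q , _)))  = ⊥-elim (¬q q)
  moves≡1⇐ _       _       (no ¬r) (inj₁ (_ , _ , r))         = ⊥-elim (¬r r)
  moves≡1⇐ _       _       (no ¬r) (inj₂ (inj₁ (_ , _ , r)))  = ⊥-elim (¬r r)

  moves≡2⇒ : ∀ p q r → moves₃ p q r ≡ 2 →
             (P × ¬ Q × ¬ R) ⊎ (¬ P × Q × ¬ R) ⊎ (¬ P × ¬ Q × R)
  moves≡2⇒ (yes p) (no ¬q) (no ¬r) _ = inj₁ (p , ¬q , ¬r)
  moves≡2⇒ (no ¬p) (yes q) (no ¬r) _ = inj₂ (inj₁ (¬p , q , ¬r))
  moves≡2⇒ (no ¬p) (no ¬q) (yes r) _ = inj₂ (inj₂ (¬p , ¬q , r))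
  moves≡2⇒ (no _)  (no _)  (no _)  ()
  moves≡2⇒ (no _)  (yes _) (yes _) ()
  moves≡2⇒ (yes _) (no _)  (yes _) ()
  moves≡2⇒ (yes _) (yes _) (yes _) ()
  moves≡2⇒ (yes _) (yes _) (no _)  ()

  moves≡2⇐ : ∀ p q r → (P × ¬ Q × ¬ R) ⊎ (¬ P × Q × ¬ R) ⊎ (¬ P × ¬ Q × R) → moves₃ p q r ≡ 2
  moves≡2⇐ (yes _) (no _)  (no _)  _ = refl
  moves≡2⇐ (no _)  (yes _) (no _)  _ = refl
  moves≡2⇐ (no _)  (no _)  (yes _) _ = refl
  moves≡2⇐ (no ¬p) (no ¬q) (no ¬r) (inj₁ (p , _ , _))        = ⊥-elim (¬p p)
  moves≡2⇐ (no ¬p) (no ¬q) (no ¬r) (inj₂ (inj₁ (_ , q , _))) = ⊥-elim (¬q q)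
  moves≡2⇐ (no ¬p) (no ¬q) (no ¬r) (inj₂ (inj₂ (_ , _ , r))) = ⊥-elim (¬r r)
  moves≡2⇐ (yes p) _       _       (inj₂ (inj₁ (¬p , _ , _)))  = ⊥-elim (¬p p)
  moves≡2⇐ (yes p) _       _       (inj₂ (inj₂ (¬p , _ , _)))  = ⊥-elim (¬p p)
  moves≡2⇐ _       (yes q) _       (inj₁ (_ , ¬q , _))         = ⊥-elim (¬q q)
  moves≡2⇐ _       (yes q) _       (inj₂ (inj₂ (_ , ¬q , _)))  = ⊥-elim (¬q q)
  moves≡2⇐ _       _       (yes r) (inj₁ (_ , _ , ¬r))         = ⊥-elim (¬r r)
  moves≡2⇐ _       _       (yes r) (inj₂ (inj₁ (_ , _ , ¬r)))  = ⊥-elim (¬r r)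

hasSize-<3 : {A : Set} {P : A → Set} {d : A → ℕ} {m n o : ℕ} →
             HasSize (λ x → P x × d x ≡ 0) m → HasSize (λ x → P x × d x ≡ 1) n →
             HasSize (λ x → P x × d x ≡ 2) o → HasSize (λ x → P x × d x ℕ.< 3) (m ℕ.+ (n ℕ.+ o))
hasSize-<3 {P = P} {d} s₀ s₁ s₂ = hasSize-cong
  (λ { (inj₁ (p , eq))        → p , subst (ℕ._< 3) (sym eq) (s≤s z≤n)
     ; (inj₂ (inj₁ (p , eq))) → p , subst (ℕ._< 3) (sym eq) (s≤s (s≤s z≤n))
     ; (inj₂ (inj₂ (p , eq))) → p , subst (ℕ._< 3) (sym eq) (s≤s (s≤s (s≤s z≤n))) })
  (λ (p , d<3) → below p _ refl d<3)
  (hasSize-∪ (λ (_ , d≡0) → [ (λ (_ , d≡1) → ℕ.0≢1+n (trans (sym d≡0) d≡1))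
                            , (λ (_ , d≡2) → ℕ.0≢1+n (trans (sym d≡0) d≡2)) ]′)
    s₀ (hasSize-∪ (λ (_ , d≡1) (_ , d≡2) → ℕ.0≢1+n (ℕ.suc-injective (trans (sym d≡1) d≡2))) s₁ s₂))
  where
  below : ∀ {x} → P x → ∀ e → d x ≡ e → e ℕ.< 3 →
          (P x × d x ≡ 0) ⊎ (P x × d x ≡ 1) ⊎ (P x × d x ≡ 2)
  below p 0 eq _ = inj₁ (p , eq)
  below p 1 eq _ = inj₂ (inj₁ (p , eq))
  below p 2 eq _ = inj₂ (inj₂ (p , eq))
  below p (suc (suc (suc _))) _ (s≤s (s≤s (s≤s ())))

inhabited? : {A : Set} {P : A → Set} {n : ℕ} → HasSize P n → ∃ P ⊎ (∀ {x} → ¬ P x)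
inhabited? h with HasSize.elements h | HasSize.sound h | HasSize.complete h
... | []    | _     | complete = inj₂ (λ p → case complete p of λ ())
... | x ∷ _ | sound | _        = inj₁ (x , sound (here refl))

module SurfaceCount (K : OddField) (k : OddField.F K) where
  open FieldArithmetic K
  open Surface K k

  fixedA? : Decidable FixedA
  fixedA? v@(a , b , c) = (s v + s v) ≟ (b * c)
  fixedB? : Decidable FixedB
  fixedB? v@(a , b , c) = (s v + s v) ≟ (c * a)
  fixedC? : Decidable FixedC
  fixedC? v@(a , b , c) = (s v + s v) ≟ (a * b)

  moved : Point → ℕ
  moved v = moves (fixedA? v) ℕ.+ (moves (fixedB? v) ℕ.+ moves (fixedC? v))

  -- Cyclic rotation of the coordinates

  rotate unrotate : Point → Point
  rotate   (a , b , c) = b , c , a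
  unrotate (a , b , c) = c , a , b

  s-rotate : ∀ v → s (rotate v) ≡ s v
  s-rotate (a , b , c) = solve 4 (λ a b c k → b :+ c :+ a :- k := a :+ b :+ c :- k) refl a b c k

  module _ (v : Point) where
    private
      a = proj₁ v
      b = proj₁ (proj₂ v)
      c = proj₂ (proj₂ v)

    abc≡bca : a * b * c ≡ b * c * a
    abc≡bca = solve 3 (λ a b c → a :* b :* c := b :* c :* a) refl a b c

    onSurface-rotate : OnSurface v → OnSurface (rotate v)
    onSurface-rotate on = trans (cong (λ t → t * t) (s-rotate v)) (trans on abc≡bca)

    onSurface-unrotate : OnSurface (rotate v) → OnSurface v
    onSurface-unrotate on =
      trans (cong (λ t → t * t) (sym (s-rotate v))) (trans on (sym abc≡bca))

    doubled-rotate : ∀ {x} → s v + s v ≡ x → s (rotate v) + s (rotate v) ≡ x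
    doubled-rotate = trans (cong (λ t → t + t) (s-rotate v))

    doubled-unrotate : ∀ {x} → s (rotate v) + s (rotate v) ≡ x → s v + s v ≡ x
    doubled-unrotate = trans (cong (λ t → t + t) (sym (s-rotate v)))

  hasSize-rotate : ∀ {P n} → HasSize P n → HasSize (P ∘ rotate) n
  hasSize-rotate = hasSize-bij unrotate rotate id id (λ _ → refl) (λ _ → refl)

  MovedOnlyB MovedOnlyC FixedOnlyB FixedOnlyC : Point → Set
  MovedOnlyB v = OnSurface v × FixedA v × ¬ FixedB v × FixedC v
  MovedOnlyC v = OnSurface v × FixedA v × FixedB v × ¬ FixedC v
  FixedOnlyB v = OnSurface v × ¬ FixedA v × FixedB v × ¬ FixedC v
  FixedOnlyC v = OnSurface v × ¬ FixedA v × ¬ FixedB v × FixedC v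

  -- At `rotate v` the conditions `FixedA`, `FixedB`, `FixedC` become `FixedB`, `FixedC`, `FixedA`
  -- at `v`, so one rotation carries type B to type A; the three lemmas that follow use the same
  -- shift.
  movedOnlyB-size : ∀ {n} → HasSize MovedOnlyA n → HasSize MovedOnlyB n
  movedOnlyB-size = hasSize-cong
    (λ {v} (on , nA , fB , fC) → onSurface-unrotate v on , doubled-unrotate v fC ,
       nA ∘ doubled-rotate v , doubled-unrotate v fB)
    (λ {v} (on , fA , nB , fC) → onSurface-rotate v on , nB ∘ doubled-unrotate v ,
       doubled-rotate v fC , doubled-rotate v fA)
    ∘ hasSize-rotate

  movedOnlyC-size : ∀ {n} → HasSize MovedOnlyB n → HasSize MovedOnlyC n
  movedOnlyC-size = hasSize-cong
    (λ {v} (on , fA , nB , fC) → onSurface-unrotate v on , doubled-unrotate v fC ,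
       doubled-unrotate v fA , nB ∘ doubled-rotate v)
    (λ {v} (on , fA , fB , nC) → onSurface-rotate v on , doubled-rotate v fB ,
       nC ∘ doubled-unrotate v , doubled-rotate v fA)
    ∘ hasSize-rotate

  fixedOnlyB-size : ∀ {n} → HasSize FixedOnlyA n → HasSize FixedOnlyB n
  fixedOnlyB-size = hasSize-cong
    (λ {v} (on , fA , nB , nC) → onSurface-unrotate v on , nC ∘ doubled-rotate v ,
       doubled-unrotate v fA , nB ∘ doubled-rotate v)
    (λ {v} (on , nA , fB , nC) → onSurface-rotate v on , doubled-rotate v fB ,
       nC ∘ doubled-unrotate v , nA ∘ doubled-unrotate v)
    ∘ hasSize-rotate

  fixedOnlyC-size : ∀ {n} → HasSize FixedOnlyB n → HasSize FixedOnlyC n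
  fixedOnlyC-size = hasSize-cong
    (λ {v} (on , nA , fB , nC) → onSurface-unrotate v on , nC ∘ doubled-rotate v ,
       nA ∘ doubled-rotate v , doubled-unrotate v fB)
    (λ {v} (on , nA , nB , fC) → onSurface-rotate v on , nB ∘ doubled-unrotate v ,
       doubled-rotate v fC , nA ∘ doubled-unrotate v)
    ∘ hasSize-rotate

  OfDegree : ℕ → Point → Set
  OfDegree d v = OnSurface v × moved v ≡ d

  ofDegree0-size : ∀ {n} → HasSize FixedAll n → HasSize (OfDegree 0) n
  ofDegree0-size = hasSize-cong
    (λ {v} (on , f) → on , moves≡0⇐ (fixedA? v) (fixedB? v) (fixedC? v) f)
    (λ {v} (on , m) → on , moves≡0⇒ (fixedA? v) (fixedB? v) (fixedC? v) m)

  ofDegree1-size : ∀ {n} → HasSize MovedOnlyA n → HasSize (OfDegree 1) (n ℕ.+ (n ℕ.+ n))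
  ofDegree1-size size = hasSize-cong
    (λ {v} → [ (λ (on , f) → on , moves≡1⇐ (fixedA? v) (fixedB? v) (fixedC? v) (inj₁ f))
      , [ (λ (on , f) → on , moves≡1⇐ (fixedA? v) (fixedB? v) (fixedC? v) (inj₂ (inj₁ f)))
        , (λ (on , f) → on , moves≡1⇐ (fixedA? v) (fixedB? v) (fixedC? v) (inj₂ (inj₂ f))) ]′ ]′)
    (λ {v} (on , m) →
      [ (λ f → inj₁ (on , f))
      , [ (λ f → inj₂ (inj₁ (on , f))) , (λ f → inj₂ (inj₂ (on , f))) ]′ ]′
      (moves≡1⇒ (fixedA? v) (fixedB? v) (fixedC? v) m))
    (hasSize-∪ (λ { (_ , nA , _) (inj₁ (_ , fA , _)) → nA fA
                  ; (_ , nA , _) (inj₂ (_ , fA , _)) → nA fA })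
      size
      (hasSize-∪ (λ (_ , _ , nB , _) (_ , _ , fB , _) → nB fB)
        (movedOnlyB-size size) (movedOnlyC-size (movedOnlyB-size size))))

  ofDegree2-size : ∀ {n} → HasSize FixedOnlyA n → HasSize (OfDegree 2) (n ℕ.+ (n ℕ.+ n))
  ofDegree2-size size = hasSize-cong
    (λ {v} → [ (λ (on , f) → on , moves≡2⇐ (fixedA? v) (fixedB? v) (fixedC? v) (inj₁ f))
      , [ (λ (on , f) → on , moves≡2⇐ (fixedA? v) (fixedB? v) (fixedC? v) (inj₂ (inj₁ f)))
        , (λ (on , f) → on , moves≡2⇐ (fixedA? v) (fixedB? v) (fixedC? v) (inj₂ (inj₂ f))) ]′ ]′)
    (λ {v} (on , m) →
      [ (λ f → inj₁ (on , f))
      , [ (λ f → inj₂ (inj₁ (on , f))) , (λ f → inj₂ (inj₂ (on , f))) ]′ ]′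
      (moves≡2⇒ (fixedA? v) (fixedB? v) (fixedC? v) m))
    (hasSize-∪ (λ { (_ , fA , _) (inj₁ (_ , nA , _)) → nA fA
                  ; (_ , fA , _) (inj₂ (_ , nA , _)) → nA fA })
      size
      (hasSize-∪ (λ (_ , _ , fB , _) (_ , _ , nB , _) → nB fB)
        (fixedOnlyB-size size) (fixedOnlyC-size (fixedOnlyB-size size))))

-- The number of points of the surface

-- With p = 5 + r, the quadratics in r are the values of u in onSurface-size.
module SizeArithmetic where
  open +-*-Solver

  -- The first summand is `p - 2 - n`: the points of the excluded curve with `b ≠ k`, where `n` of
  -- them have `b = k`. The subscripts 0 and 1 stand for `k = 0` and `k = 4`, the signs for no root
  -- and two roots.
  row-sum₀ : ∀ r → (3 ℕ.+ r) ℕ.+ (r ℕ.* r ℕ.+ 8 ℕ.* r ℕ.+ 17)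
    ≡ (4 ℕ.+ r) ℕ.* (5 ℕ.+ r)
  row-sum₀ = solve 1 (λ r → (con 3 :+ r) :+ (r :* r :+ con 8 :* r :+ con 17)
    := (con 4 :+ r) :* (con 5 :+ r)) refl

  row-sum₁ : ∀ r → (2 ℕ.+ r) ℕ.+ (r ℕ.* r ℕ.+ 7 ℕ.* r ℕ.+ 13)
    ≡ (3 ℕ.+ r) ℕ.* (5 ℕ.+ r)
  row-sum₁ = solve 1 (λ r → (con 2 :+ r) :+ (r :* r :+ con 7 :* r :+ con 13)
    := (con 3 :+ r) :* (con 5 :+ r)) refl

  row-sum₋ : ∀ r → (3 ℕ.+ r) ℕ.+ (r ℕ.* r ℕ.+ 7 ℕ.* r ℕ.+ 12)
    ≡ (3 ℕ.+ r) ℕ.* (5 ℕ.+ r)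
  row-sum₋ = solve 1 (λ r → (con 3 :+ r) :+ (r :* r :+ con 7 :* r :+ con 12)
    := (con 3 :+ r) :* (con 5 :+ r)) refl

  row-sum₊ : ∀ r → (1 ℕ.+ r) ℕ.+ (r ℕ.* r ℕ.+ 7 ℕ.* r ℕ.+ 14)
    ≡ (3 ℕ.+ r) ℕ.* (5 ℕ.+ r)
  row-sum₊ = solve 1 (λ r → (con 1 :+ r) :+ (r :* r :+ con 7 :* r :+ con 14)
    := (con 3 :+ r) :* (con 5 :+ r)) refl

  total₀ : ∀ r → (5 ℕ.+ r) ℕ.+ ((4 ℕ.+ r) ℕ.+ (0 ℕ.* (4 ℕ.+ r) ℕ.+ (r ℕ.* r ℕ.+ 8 ℕ.* r ℕ.+ 17)))
    ≡ (5 ℕ.+ r) ℕ.^ 2 ℕ.+ 1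
  total₀ = solve 1 (λ r → (con 5 :+ r) :+ ((con 4 :+ r) :+ (con 0 :* (con 4 :+ r) :+ (r :* r :+ con 8 :* r :+ con 17)))
    := (con 5 :+ r) :^ 2 :+ con 1) refl

  total₁ : ∀ r → (5 ℕ.+ r) ℕ.+ ((4 ℕ.+ r) ℕ.+ (1 ℕ.* (4 ℕ.+ r) ℕ.+ (r ℕ.* r ℕ.+ 7 ℕ.* r ℕ.+ 13)))
    ≡ (5 ℕ.+ r) ℕ.^ 2 ℕ.+ 1
  total₁ = solve 1 (λ r → (con 5 :+ r) :+ ((con 4 :+ r) :+ (con 1 :* (con 4 :+ r) :+ (r :* r :+ con 7 :* r :+ con 13)))
    := (con 5 :+ r) :^ 2 :+ con 1) refl

  -- The `p` to be subtracted is added on the left instead.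
  total₋ : ∀ r → (5 ℕ.+ r) ℕ.+ ((4 ℕ.+ r) ℕ.+ (0 ℕ.* (4 ℕ.+ r) ℕ.+ (r ℕ.* r ℕ.+ 7 ℕ.* r ℕ.+ 12))) ℕ.+ (5 ℕ.+ r)
    ≡ (5 ℕ.+ r) ℕ.^ 2 ℕ.+ 1
  total₋ = solve 1 (λ r → (con 5 :+ r) :+ ((con 4 :+ r) :+ (con 0 :* (con 4 :+ r) :+ (r :* r :+ con 7 :* r :+ con 12))) :+ (con 5 :+ r)
    := (con 5 :+ r) :^ 2 :+ con 1) refl

  total₊ : ∀ r → (5 ℕ.+ r) ℕ.+ ((4 ℕ.+ r) ℕ.+ (2 ℕ.* (4 ℕ.+ r) ℕ.+ (r ℕ.* r ℕ.+ 7 ℕ.* r ℕ.+ 14)))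
    ≡ (5 ℕ.+ r) ℕ.^ 2 ℕ.+ 1 ℕ.+ (5 ℕ.+ r)
  total₊ = solve 1 (λ r → (con 5 :+ r) :+ ((con 4 :+ r) :+ (con 2 :* (con 4 :+ r) :+ (r :* r :+ con 7 :* r :+ con 14)))
    := (con 5 :+ r) :^ 2 :+ con 1 :+ (con 5 :+ r)) refl

module TotalCount (K : OddField) (k : OddField.F K) {r : ℕ}
  (F-size : HasSize {OddField.F K} (λ _ → ⊤) (5 ℕ.+ r)) where
  open FieldArithmetic K
  open Surface K k

  Root : F → F → Set
  Root b t = t * t - b * t + b ≡ 0#

  nonzero-size : HasSize (_≢ 0#) (4 ℕ.+ r)
  nonzero-size = hasSize-cong proj₂ (λ x≢0 → tt , x≢0) (hasSize-remove _≟_ tt F-size)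

  nonzero-≢k-size : k ≢ 0# → HasSize (λ b → b ≢ 0# × b ≢ k) (3 ℕ.+ r)
  nonzero-≢k-size k≢0 = hasSize-remove _≟_ k≢0 nonzero-size

  nonzero-≢k-size₀ : k ≡ 0# → HasSize (λ b → b ≢ 0# × b ≢ k) (4 ℕ.+ r)
  nonzero-≢k-size₀ refl = hasSize-cong (λ b≢0 → b≢0 , b≢0) proj₁ nonzero-size

  nonzero-≢k,4-size : ∀ {n} → k ≢ 4# → HasSize (λ b → b ≢ 0# × b ≢ k) (suc n) →
                      HasSize (λ b → (b ≢ 0# × b ≢ k) × b ≢ 4#) n
  nonzero-≢k,4-size k≢4 = hasSize-remove _≟_ (4≢0 , k≢4 ∘ sym)

  -- Root b t says t² = b (t - 1), so t determines b.
  root-curve-size : HasSize (λ (b , t) → b ≢ 0# × Root b t) (3 ℕ.+ r)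
  root-curve-size = hasSize-bij {Q = λ (b , t) → b ≢ 0# × Root b t}
    (λ t → t * t / (t - 1ᶠ) , t) proj₂
    (λ {t} (t≢0 , t≢1) →
      let b[t-1]≡t² = div-* {x = t * t} (x≢y⇒x-y≢0 t≢1) in
        (λ b≡0 → *≢0 t≢0 t≢0 (trans (sym b[t-1]≡t²)
          (trans (cong (_* (t - 1ᶠ)) b≡0) (zeroˡ (t - 1ᶠ)))))
      , combine₁ (- 1ᶠ) b[t-1]≡t² (solve 2 (λ b t →
          t :* t :- b :* t :+ b :- κ 0 := (:- κ 1) :* (b :* (t :- κ 1) :- t :* t)) refl _ t))
    (λ {(b , t)} (b≢0 , root) →
        (λ { refl → b≢0 (combine₁ 1ᶠ root (solve 1 (λ b →
          b :- κ 0 := κ 1 :* (κ 0 :* κ 0 :- b :* κ 0 :+ b :- κ 0)) refl b)) })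
      , t≢1 root)
    (λ _ → refl)
    (λ {(b , t)} (b≢0 , root) → cong (_, t) (div-unique (x≢y⇒x-y≢0 (t≢1 root))
      (combine₁ (- 1ᶠ) root (solve 2 (λ b t →
        b :* (t :- κ 1) :- t :* t := (:- κ 1) :* (t :* t :- b :* t :+ b :- κ 0)) refl b t))))
    -- The parameter `t` omits 0, where `b` would vanish, and 1, where the curve has no point.
    (hasSize-remove _≟_ (λ eq → 1≢0 (trans (sym (+-identityʳ 1#)) eq)) nonzero-size)
    where
    t≢1 : ∀ {b t} → Root b t → t ≢ 1ᶠ
    t≢1 {b} root refl = 1≢0 (trans (sym (+-identityʳ 1#)) (trans
      (solve 1 (λ b → κ 1 := κ 1 :* κ 1 :- b :* κ 1 :+ b) refl b) root))

  -- Complement taken twice: from the curve the `n` points over `b = k` are removed, leaving `w`,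
  -- and these are removed from all `m * p` pairs, leaving `u`.
  nonroot-size : ∀ {m n w u} → HasSize (λ b → b ≢ 0# × b ≢ k) m → HasSize (λ t → k ≢ 0# × Root k t) n →
                 n ℕ.+ w ≡ 3 ℕ.+ r → w ℕ.+ u ≡ m ℕ.* (5 ℕ.+ r) →
                 HasSize (λ (b , t) → (b ≢ 0# × b ≢ k) × ¬ Root b t) u
  nonroot-size {w = w} {u} bs roots n+w w+u = hasSize-cong
    (λ ((b≢ , _) , ¬root) → b≢ , ¬root) (λ (b≢ , ¬root) → (b≢ , tt) , ¬root)
    (hasSize-∖ {Q = λ (b , t) → Root b t} (λ (b , t) → (t * t - b * t + b) ≟ 0#)
      (subst (HasSize _) (sym w+u) (hasSize-× bs F-size))
      (hasSize-cong {P = (λ (b , t) → b ≢ 0# × Root b t) ∩ (λ (b , t) → b ≢ k)}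
        (λ ((b≢0 , root) , b≢k) → ((b≢0 , b≢k) , tt) , root)
        (λ (((b≢0 , b≢k) , tt) , root) → (b≢0 , root) , b≢k)
        (hasSize-∖ {Q = λ (b , t) → b ≡ k} (λ (b , t) → b ≟ k)
          (subst (HasSize _) (sym n+w) root-curve-size)
          (hasSize-bij (k ,_) proj₂ (λ root → root , refl) (λ { (root , refl) → root })
            (λ _ → refl) (λ { (_ , refl) → refl }) roots))))

  private
    b≡0? : Decidable (λ (v : Point) → proj₁ (proj₂ v) ≡ 0#)
    b≡0? v = proj₁ (proj₂ v) ≟ 0#

    b≡k? : Decidable (λ (v : Point) → proj₁ (proj₂ v) ≡ k)
    b≡k? v = proj₁ (proj₂ v) ≟ k

  -- The strata of the surface

  onSurface-b≡0-size : HasSize (OnSurface ∩ λ (a , b , c) → b ≡ 0#) (5 ℕ.+ r)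
  onSurface-b≡0-size = hasSize-bij (λ a → a , 0# , k - a) proj₁
    (λ {a} _ → solve 2 (λ a k → let t = a :+ κ 0 :+ (k :- a) :- k in
       t :* t := a :* κ 0 :* (k :- a)) refl a k , refl)
    (λ _ → tt) (λ _ → refl)
    (λ { {a , _ , c} (on , refl) → cong (λ c → a , 0# , c)
      -- For `b` zero the equation reads `s² = 0`, so the stratum is the line `a + c = k`.
      (combine₁ (- 1ᶠ) (square-zero (trans on (solve 2 (λ a c → a :* κ 0 :* c := κ 0) refl a c)))
        (solve 3 (λ a c k → k :- a :- c := (:- κ 1) :* (a :+ κ 0 :+ c :- k :- κ 0)) refl a c k)) })
    F-size

  onSurface-a≡0-size : HasSize ((OnSurface ∩ λ (a , b , c) → b ≢ 0#) ∩ λ (a , b , c) → a ≡ 0#) (4 ℕ.+ r)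
  onSurface-a≡0-size = hasSize-bij (λ b → 0# , b , k - b) (proj₁ ∘ proj₂)
    (λ {b} b≢0 → (solve 2 (λ b k → let t = κ 0 :+ b :+ (k :- b) :- k in
       t :* t := κ 0 :* b :* (k :- b)) refl b k , b≢0) , refl)
    (λ ((_ , b≢0) , _) → b≢0) (λ _ → refl)
    (λ { {_ , b , c} ((on , _) , refl) → cong (λ c → 0# , b , c)
      (combine₁ (- 1ᶠ) (square-zero (trans on (solve 2 (λ b c → κ 0 :* b :* c := κ 0) refl b c)))
        (solve 3 (λ b c k → k :- b :- c := (:- κ 1) :* (κ 0 :+ b :+ c :- k :- κ 0)) refl b c k)) })
    nonzero-size

  -- The point of the surface with given a, b and s = t a.
  pointWithSlope : F → F → F → Point
  pointWithSlope a b t = a , b , t * a + k - a - b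

  slope : Point → F
  slope v = s v / proj₁ v

  s-pointWithSlope : ∀ a b t → s (pointWithSlope a b t) ≡ t * a
  s-pointWithSlope a b t = solve 4 (λ a b t k →
    a :+ b :+ (t :* a :+ k :- a :- b) :- k := t :* a) refl a b t k

  slope-pointWithSlope : ∀ {a b t} → a ≢ 0# → slope (pointWithSlope a b t) ≡ t
  slope-pointWithSlope {a} {b} {t} a≢0 = div-unique a≢0 (sym (s-pointWithSlope a b t))

  pointWithSlope-slope : ∀ {a b c} → a ≢ 0# → pointWithSlope a b (slope (a , b , c)) ≡ (a , b , c)
  pointWithSlope-slope {a} {b} {c} a≢0 = cong (λ c → a , b , c) (combine₁ 1ᶠ (div-* a≢0)
    (solve 5 (λ a b c k ta → ta :+ k :- a :- b :- c := κ 1 :* (ta :- (a :+ b :+ c :- k)))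
      refl a b c k (slope (a , b , c) * a)))

  -- Substituting `s = ta` and `c = ta + k - a - b` gives the equation a factor `a`; what remains is
  -- linear in `a`.
  pointWithSlope-onSurface : ∀ {a b t} → a * (t * t - b * t + b) ≡ b * (k - b) →
                             OnSurface (pointWithSlope a b t)
  pointWithSlope-onSurface {a} {b} {t} eq = trans
    (cong (λ s → s * s) (s-pointWithSlope a b t))
    (combine₁ a eq (solve 4 (λ a b t k →
      t :* a :* (t :* a) :- a :* b :* (t :* a :+ k :- a :- b) :=
      a :* (a :* (t :* t :- b :* t :+ b) :- b :* (k :- b))) refl a b t k))

  onSurface-slope : ∀ {a b c} → a ≢ 0# → OnSurface (a , b , c) →
    let t = slope (a , b , c) in a * (t * t - b * t + b) ≡ b * (k - b)
  onSurface-slope {a} {b} {c} a≢0 on = x-y≡0⇒x≡y (cancel a≢0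
    (combine₂ 1ᶠ (t * a + s′ - a * b) on (div-* a≢0) (solve 5 (λ a b c k t →
      let s = a :+ b :+ c :- k in
      a :* (a :* (t :* t :- b :* t :+ b) :- b :* (k :- b)) :- κ 0 :=
      κ 1 :* (s :* s :- a :* b :* c) :+ (t :* a :+ s :- a :* b) :* (t :* a :- s))
      refl a b c k t)))
    where
    s′ = s (a , b , c)
    t = slope (a , b , c)

  -- The clause `k ≢ 0#` sits in the root predicate because this stratum has `b ≢ 0#`: at `k = 0` it
  -- is empty although `t = 0` satisfies `Root k t`.
  onSurface-b≡k-size : ∀ {n} → HasSize (λ t → k ≢ 0# × Root k t) n →
    HasSize (((OnSurface ∩ λ (a , b , c) → b ≢ 0#) ∩ λ (a , b , c) → a ≢ 0#) ∩ λ (a , b , c) → b ≡ k)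
            (n ℕ.* (4 ℕ.+ r))
  onSurface-b≡k-size roots = hasSize-bij
    (λ (t , a) → pointWithSlope a k t) (λ v → slope v , proj₁ v)
    (λ { {t , a} ((k≢0 , root) , a≢0) →
      ((pointWithSlope-onSurface (combine₁ a root (solve 3 (λ a t k →
          a :* (t :* t :- k :* t :+ k) :- k :* (k :- k) :=
          a :* (t :* t :- k :* t :+ k :- κ 0)) refl a t k)) , k≢0) , a≢0) , refl })
    (λ { {a , _ , c} (((on , k≢0) , a≢0) , refl) →
      (k≢0 , cancel a≢0 (trans (onSurface-slope a≢0 on)
        (solve 1 (λ k → k :* (k :- k) := κ 0) refl k))) , a≢0 })
    (λ { {t , a} (_ , a≢0) → cong (_, a) (slope-pointWithSlope a≢0) })
    (λ { ((_ , a≢0) , refl) → pointWithSlope-slope a≢0 })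
    (hasSize-× roots nonzero-size)

  -- Here `b * (k - b)` is nonzero. Hence the coefficient of `a` cannot vanish, and the unique
  -- solution `apex b t` is itself nonzero, so its slope can be recovered by division.
  onSurface-b≢k-size : ∀ {n} → HasSize (λ (b , t) → (b ≢ 0# × b ≢ k) × ¬ Root b t) n →
    HasSize (((OnSurface ∩ λ (a , b , c) → b ≢ 0#) ∩ λ (a , b , c) → a ≢ 0#) ∩ λ (a , b , c) → b ≢ k) n
  onSurface-b≢k-size = hasSize-bij
    (λ (b , t) → pointWithSlope (apex b t) b t) (λ v → proj₁ (proj₂ v) , slope v)
    (λ { {b , t} ((b≢0 , b≢k) , ¬root) →
      ((pointWithSlope-onSurface (div-* ¬root) , b≢0) , apex≢0 b≢0 b≢k ¬root) , b≢k })
    (λ { {a , b , c} (((on , b≢0) , a≢0) , b≢k) → (b≢0 , b≢k) , ¬root on b≢0 a≢0 b≢k })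
    (λ { {b , t} ((b≢0 , b≢k) , ¬root) →
      cong (b ,_) (slope-pointWithSlope (apex≢0 b≢0 b≢k ¬root)) })
    (λ { {a , b , c} (((on , b≢0) , a≢0) , b≢k) → trans
      (cong (λ a′ → pointWithSlope a′ b (slope (a , b , c)))
        (div-unique (¬root on b≢0 a≢0 b≢k) (onSurface-slope a≢0 on)))
      (pointWithSlope-slope a≢0) })
    where
    apex : F → F → F
    apex b t = b * (k - b) / (t * t - b * t + b)

    apex≢0 : ∀ {b t} → b ≢ 0# → b ≢ k → ¬ Root b t → apex b t ≢ 0#
    apex≢0 {b} {t} b≢0 b≢k ¬root apex≡0 = *≢0 b≢0 (x≢y⇒x-y≢0 (b≢k ∘ sym))
      (trans (sym (div-* ¬root)) (trans (cong (_* (t * t - b * t + b)) apex≡0)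
        (zeroˡ (t * t - b * t + b))))

    ¬root : ∀ {a b c} → OnSurface (a , b , c) → b ≢ 0# → a ≢ 0# → b ≢ k →
            ¬ Root b (slope (a , b , c))
    ¬root {a} on b≢0 a≢0 b≢k root = *≢0 b≢0 (x≢y⇒x-y≢0 (b≢k ∘ sym))
      (trans (sym (onSurface-slope a≢0 on)) (trans (cong (a *_) root) (zeroʳ a)))

  onSurface-size : ∀ {m n w u} →
    HasSize (λ b → b ≢ 0# × b ≢ k) m → HasSize (λ t → k ≢ 0# × Root k t) n →
    n ℕ.+ w ≡ 3 ℕ.+ r → w ℕ.+ u ≡ m ℕ.* (5 ℕ.+ r) →
    HasSize OnSurface ((5 ℕ.+ r) ℕ.+ ((4 ℕ.+ r) ℕ.+ (n ℕ.* (4 ℕ.+ r) ℕ.+ u)))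
  onSurface-size bs roots n+w w+u =
    hasSize-split b≡0? onSurface-b≡0-size
      (hasSize-split a≟0 onSurface-a≡0-size
        (hasSize-split b≡k? (onSurface-b≡k-size roots)
          (onSurface-b≢k-size (nonroot-size bs roots n+w w+u))))

  -- Roots of `t² - kt + k`

  roots-size₀ : k ≡ 0# → HasSize (λ t → k ≢ 0# × Root k t) 0
  roots-size₀ k≡0 = hasSize-∅ (λ (k≢0 , _) → k≢0 k≡0)

  roots-size₄ : k ≡ 4# → HasSize (λ t → k ≢ 0# × Root k t) 1
  roots-size₄ refl = hasSize-cong
    (λ { refl → 4≢0 , solve 0 (κ 2 :* κ 2 :- κ 4 :* κ 2 :+ κ 4 := κ 0) refl })
    (λ {t} (_ , root) → x-y≡0⇒x≡y (square-zero (trans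
      (solve 1 (λ t → (t :- κ 2) :* (t :- κ 2) := t :* t :- κ 4 :* t :+ κ 4) refl t) root)))
    (hasSize-singleton (fromℕ 2))

  -- With t also k - t is a root, and the discriminant is k (k - 4).
  roots-size : k ≢ 0# → k ≢ 4# →
    HasSize (λ t → k ≢ 0# × Root k t) 0 ⊎ HasSize (λ t → k ≢ 0# × Root k t) 2
  roots-size k≢0 k≢4
    with inhabited? (hasSize-filter {Q = Root k} (λ t → (t * t - k * t + k) ≟ 0#) F-size)
  ... | inj₂ none = inj₁ (hasSize-∅ (λ (_ , root) → none (tt , root)))
  ... | inj₁ (t , _ , root) = inj₂ (hasSize-cong
      [ (λ { refl → k≢0 , root }) , (λ { refl → k≢0 , root′ }) ]′
      (λ {u} (_ , root-u) →
        [ inj₁ ∘ x-y≡0⇒x≡y , inj₂ ∘ x-y≡0⇒x≡y ]′ (zero-product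
          (combine₂ 1ᶠ (- 1ᶠ) root-u root (solve 3 (λ t u k →
            (u :- t) :* (u :- (k :- t)) :- κ 0 :=
            κ 1 :* (u :* u :- k :* u :+ k :- κ 0) :+
            (:- κ 1) :* (t :* t :- k :* t :+ k :- κ 0)) refl t u k))))
      (hasSize-∪ (λ u≡t u≡k-t → distinct (trans (sym u≡t) u≡k-t))
        (hasSize-singleton t) (hasSize-singleton (k - t))))
    where
    root′ : Root k (k - t)
    root′ = trans (solve 2 (λ t k →
      (k :- t) :* (k :- t) :- k :* (k :- t) :+ k := t :* t :- k :* t :+ k) refl t k) root

    distinct : t ≢ k - t
    distinct t≡k-t = *≢0 k≢0 (x≢y⇒x-y≢0 k≢4) (combine₂ (t + t - k) (- 4#) t≡k-t root
      (solve 2 (λ t k → k :* (k :- κ 4) :- κ 0 :=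
        (t :+ t :- k) :* (t :- (k :- t)) :+ (:- κ 4) :* (t :* t :- k :* t :+ k :- κ 0)) refl t k))

  open SizeArithmetic

  onSurface-size₀ : k ≡ 0# → HasSize OnSurface ((5 ℕ.+ r) ℕ.^ 2 ℕ.+ 1)
  onSurface-size₀ k≡0 = subst (HasSize OnSurface) (total₀ r)
    (onSurface-size (nonzero-≢k-size₀ k≡0) (roots-size₀ k≡0) refl (row-sum₀ r))

  onSurface-size₄ : k ≡ 4# → HasSize OnSurface ((5 ℕ.+ r) ℕ.^ 2 ℕ.+ 1)
  onSurface-size₄ k≡4 = subst (HasSize OnSurface) (total₁ r)
    (onSurface-size (nonzero-≢k-size (λ k≡0 → 4≢0 (trans (sym k≡4) k≡0)))
      (roots-size₄ k≡4) refl (row-sum₁ r))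

  onSurface-size± : k ≢ 0# → k ≢ 4# →
    HasSize OnSurface ((5 ℕ.+ r) ℕ.^ 2 ℕ.+ 1 ℕ.+ (5 ℕ.+ r))
    ⊎ HasSize OnSurface ((5 ℕ.+ r) ℕ.^ 2 ℕ.+ 1 ℕ.∸ (5 ℕ.+ r))
  onSurface-size± k≢0 k≢4 with roots-size k≢0 k≢4
  ... | inj₁ none = inj₂ (subst (HasSize OnSurface)
    -- The stratum sum equals itself plus `p`, minus `p`, so `∸` does not truncate.
    (trans (sym (ℕ.m+n∸n≡m _ (5 ℕ.+ r))) (cong (ℕ._∸ (5 ℕ.+ r)) (total₋ r)))
    (onSurface-size (nonzero-≢k-size k≢0) none refl (row-sum₋ r)))
  ... | inj₂ two = inj₁ (subst (HasSize OnSurface) (total₊ r)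
    (onSurface-size (nonzero-≢k-size k≢0) two refl (row-sum₊ r)))

-- The Vieta cubic as a translate of the surface

moves-size : {A : Set} {P : Set} {u v : A} → (P → u ≡ v) → (u ≡ v → P) → (d : Dec P) →
             HasSize (λ w → w ≡ u × w ≢ v) (moves d)
moves-size P⇒u≡v u≡v⇒P (yes p) =
  hasSize-∅ (λ (w≡u , w≢v) → w≢v (trans w≡u (P⇒u≡v p)))
moves-size {u = u} P⇒u≡v u≡v⇒P (no ¬p) = hasSize-cong
  (λ { refl → refl , ¬p ∘ u≡v⇒P }) proj₁ (hasSize-singleton u)

module VietaParameters (K : OddField) where
  open FieldArithmetic K

  -- q = C / 4 makes D = 4 - 2C - C²/4 a polynomial.
  record IsParametrised (C D q : F) : Set where
    field
      C≡4q : C ≡ 4# * q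
      D≡   : D ≡ 4# - fromℕ 8 * q - 4# * (q * q)

module VietaCubic (K : OddField) (C D q : OddField.F K)
  (isParametrised : VietaParameters.IsParametrised K C D q) where
  open FieldArithmetic K
  open VietaParameters.IsParametrised isParametrised

  k : F
  k = 4# - fromℕ 2 * q

  open Surface K k
  open SurfaceCount K k

  Solution : Point → Set
  Solution (x , y , z) = x * x + y * y + z * z ≡ x * y * z - C * (x + y + z) + D

  flipX flipY flipZ shift unshift : Point → Point
  flipX (x , y , z) = y * z - C - x , y , z
  flipY (x , y , z) = x , x * z - C - y , z
  flipZ (x , y , z) = x , y , x * y - C - z
  shift   (x , y , z) = x + fromℕ 2 , y + fromℕ 2 , z + fromℕ 2
  unshift (x , y , z) = x - fromℕ 2 , y - fromℕ 2 , z - fromℕ 2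

  unshift-shift : ∀ v → unshift (shift v) ≡ v
  unshift-shift (x , y , z) = cong₂ _,_ (eq x) (cong₂ _,_ (eq y) (eq z))
    where
    eq : ∀ x → x + fromℕ 2 - fromℕ 2 ≡ x
    eq = solve 1 (λ x → x :+ κ 2 :- κ 2 := x) refl

  shift-unshift : ∀ v → shift (unshift v) ≡ v
  shift-unshift (x , y , z) = cong₂ _,_ (eq x) (cong₂ _,_ (eq y) (eq z))
    where
    eq : ∀ x → x - fromℕ 2 + fromℕ 2 ≡ x
    eq = solve 1 (λ x → x :- κ 2 :+ κ 2 := x) refl

  -- The difference `s² - abc` is the cubic with `C` and `D` replaced by their expressions in `q`;
  -- the multipliers correct for that replacement.
  solution⇒onSurface : ∀ v → Solution v → OnSurface (shift v)
  solution⇒onSurface (x , y , z) sol = combine₃ 1ᶠ (- (x + y + z)) 1ᶠ sol C≡4q D≡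
    (solve 6 (λ x y z C D q →
      let a = x :+ κ 2; b = y :+ κ 2; c = z :+ κ 2; s = a :+ b :+ c :- (κ 4 :- κ 2 :* q) in
      s :* s :- a :* b :* c :=
      κ 1 :* (x :* x :+ y :* y :+ z :* z :- (x :* y :* z :- C :* (x :+ y :+ z) :+ D))
      :+ (:- (x :+ y :+ z)) :* (C :- κ 4 :* q)
      :+ κ 1 :* (D :- (κ 4 :- κ 8 :* q :- κ 4 :* (q :* q)))) refl x y z C D q)

  onSurface⇒solution : ∀ v → OnSurface (shift v) → Solution v
  onSurface⇒solution (x , y , z) on = combine₃ 1ᶠ (x + y + z) (- 1ᶠ) on C≡4q D≡
    (solve 6 (λ x y z C D q →
      let a = x :+ κ 2; b = y :+ κ 2; c = z :+ κ 2; s = a :+ b :+ c :- (κ 4 :- κ 2 :* q) in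
      x :* x :+ y :* y :+ z :* z :- (x :* y :* z :- C :* (x :+ y :+ z) :+ D) :=
      κ 1 :* (s :* s :- a :* b :* c)
      :+ (x :+ y :+ z) :* (C :- κ 4 :* q)
      :+ (:- κ 1) :* (D :- (κ 4 :- κ 8 :* q :- κ 4 :* (q :* q)))) refl x y z C D q)

  -- The cubic is a monic quadratic in `x` with root sum `yz - C`, and replacing one root by the
  -- other does not change the difference of its two sides.
  solution-flipX : ∀ v → Solution v → Solution (flipX v)
  solution-flipX (x , y , z) sol = combine₁ 1ᶠ sol (solve 5 (λ x y z C D →
    let x′ = y :* z :- C :- x in
    x′ :* x′ :+ y :* y :+ z :* z :- (x′ :* y :* z :- C :* (x′ :+ y :+ z) :+ D) :=
    κ 1 :* (x :* x :+ y :* y :+ z :* z :- (x :* y :* z :- C :* (x :+ y :+ z) :+ D)))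
    refl x y z C D)

  solution-flipY : ∀ v → Solution v → Solution (flipY v)
  solution-flipY (x , y , z) sol = combine₁ 1ᶠ sol (solve 5 (λ x y z C D →
    let y′ = x :* z :- C :- y in
    x :* x :+ y′ :* y′ :+ z :* z :- (x :* y′ :* z :- C :* (x :+ y′ :+ z) :+ D) :=
    κ 1 :* (x :* x :+ y :* y :+ z :* z :- (x :* y :* z :- C :* (x :+ y :+ z) :+ D)))
    refl x y z C D)

  solution-flipZ : ∀ v → Solution v → Solution (flipZ v)
  solution-flipZ (x , y , z) sol = combine₁ 1ᶠ sol (solve 5 (λ x y z C D →
    let z′ = x :* y :- C :- z in
    x :* x :+ y :* y :+ z′ :* z′ :- (x :* y :* z′ :- C :* (x :+ y :+ z′) :+ D) :=
    κ 1 :* (x :* x :+ y :* y :+ z :* z :- (x :* y :* z :- C :* (x :+ y :+ z) :+ D)))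
    refl x y z C D)

  flip-involutive : ∀ x e → e - C - (e - C - x) ≡ x
  flip-involutive x e = solve 3 (λ x e C → e :- C :- (e :- C :- x) := x) refl x e C

  flipX-involutive : ∀ v → flipX (flipX v) ≡ v
  flipX-involutive (x , y , z) = cong (_, y , z) (flip-involutive x (y * z))

  flipY-involutive : ∀ v → flipY (flipY v) ≡ v
  flipY-involutive (x , y , z) = cong (λ y → x , y , z) (flip-involutive y (x * z))

  flipZ-involutive : ∀ v → flipZ (flipZ v) ≡ v
  flipZ-involutive (x , y , z) = cong (λ z → x , y , z) (flip-involutive z (x * y))

  -- In the original coordinates `2s - bc` is `2x + C - yz`, the negative of the displacement of `x`
  -- under its flip.
  fixed⇒flipX : ∀ v → FixedA (shift v) → flipX v ≡ v
  fixed⇒flipX (x , y , z) f = cong (_, y , z) (combine₂ (- 1ᶠ) (- 1ᶠ) f C≡4q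
    (solve 5 (λ x y z C q →
      let a = x :+ κ 2; b = y :+ κ 2; c = z :+ κ 2; s = a :+ b :+ c :- (κ 4 :- κ 2 :* q) in
      y :* z :- C :- x :- x :=
      (:- κ 1) :* (s :+ s :- b :* c) :+ (:- κ 1) :* (C :- κ 4 :* q)) refl x y z C q))

  flipX⇒fixed : ∀ v → flipX v ≡ v → FixedA (shift v)
  flipX⇒fixed (x , y , z) eq = combine₂ (- 1ᶠ) (- 1ᶠ) (cong proj₁ eq) C≡4q
    (solve 5 (λ x y z C q →
      let a = x :+ κ 2; b = y :+ κ 2; c = z :+ κ 2; s = a :+ b :+ c :- (κ 4 :- κ 2 :* q) in
      s :+ s :- b :* c :=
      (:- κ 1) :* (y :* z :- C :- x :- x) :+ (:- κ 1) :* (C :- κ 4 :* q)) refl x y z C q)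

  fixed⇒flipY : ∀ v → FixedB (shift v) → flipY v ≡ v
  fixed⇒flipY (x , y , z) f = cong (λ y → x , y , z) (combine₂ (- 1ᶠ) (- 1ᶠ) f C≡4q
    (solve 5 (λ x y z C q →
      let a = x :+ κ 2; b = y :+ κ 2; c = z :+ κ 2; s = a :+ b :+ c :- (κ 4 :- κ 2 :* q) in
      x :* z :- C :- y :- y :=
      (:- κ 1) :* (s :+ s :- c :* a) :+ (:- κ 1) :* (C :- κ 4 :* q)) refl x y z C q))

  flipY⇒fixed : ∀ v → flipY v ≡ v → FixedB (shift v)
  flipY⇒fixed (x , y , z) eq = combine₂ (- 1ᶠ) (- 1ᶠ) (cong (proj₁ ∘ proj₂) eq) C≡4q
    (solve 5 (λ x y z C q →
      let a = x :+ κ 2; b = y :+ κ 2; c = z :+ κ 2; s = a :+ b :+ c :- (κ 4 :- κ 2 :* q) in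
      s :+ s :- c :* a :=
      (:- κ 1) :* (x :* z :- C :- y :- y) :+ (:- κ 1) :* (C :- κ 4 :* q)) refl x y z C q)

  fixed⇒flipZ : ∀ v → FixedC (shift v) → flipZ v ≡ v
  fixed⇒flipZ (x , y , z) f = cong (λ z → x , y , z) (combine₂ (- 1ᶠ) (- 1ᶠ) f C≡4q
    (solve 5 (λ x y z C q →
      let a = x :+ κ 2; b = y :+ κ 2; c = z :+ κ 2; s = a :+ b :+ c :- (κ 4 :- κ 2 :* q) in
      x :* y :- C :- z :- z :=
      (:- κ 1) :* (s :+ s :- a :* b) :+ (:- κ 1) :* (C :- κ 4 :* q)) refl x y z C q))

  flipZ⇒fixed : ∀ v → flipZ v ≡ v → FixedC (shift v)
  flipZ⇒fixed (x , y , z) eq = combine₂ (- 1ᶠ) (- 1ᶠ) (cong (proj₂ ∘ proj₂) eq) C≡4q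
    (solve 5 (λ x y z C q →
      let a = x :+ κ 2; b = y :+ κ 2; c = z :+ κ 2; s = a :+ b :+ c :- (κ 4 :- κ 2 :* q) in
      s :+ s :- a :* b :=
      (:- κ 1) :* (x :* y :- C :- z :- z) :+ (:- κ 1) :* (C :- κ 4 :* q)) refl x y z C q)

  -- Neighbours as moving flips

  IsFlip : Point → Point → Set
  IsFlip v w = w ≡ flipX v ⊎ w ≡ flipY v ⊎ w ≡ flipZ v

  -- Because flips are involutions, the two alternatives in `Adjacent` reduce to one.
  isFlip-sym : ∀ {v w} → IsFlip v w → IsFlip w v
  isFlip-sym {v} (inj₁ refl)        = inj₁ (sym (flipX-involutive v))
  isFlip-sym {v} (inj₂ (inj₁ refl)) = inj₂ (inj₁ (sym (flipY-involutive v)))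
  isFlip-sym {v} (inj₂ (inj₂ refl)) = inj₂ (inj₂ (sym (flipZ-involutive v)))

  isFlip-solution : ∀ {v w} → IsFlip v w → Solution v → Solution w
  isFlip-solution {v} (inj₁ refl)        = solution-flipX v
  isFlip-solution {v} (inj₂ (inj₁ refl)) = solution-flipY v
  isFlip-solution {v} (inj₂ (inj₂ refl)) = solution-flipZ v

  -- Flips of different coordinates agree only when both fix the point.
  neighbours-size : ∀ v → HasSize (λ w → IsFlip v w × w ≢ v) (moved (shift v))
  neighbours-size v@(x , y , z) = hasSize-cong
    (λ { (inj₁ (eq , w≢v))        → inj₁ eq , w≢v
       ; (inj₂ (inj₁ (eq , w≢v))) → inj₂ (inj₁ eq) , w≢v
       ; (inj₂ (inj₂ (eq , w≢v))) → inj₂ (inj₂ eq) , w≢v })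
    (λ { (inj₁ eq , w≢v)        → inj₁ (eq , w≢v)
       ; (inj₂ (inj₁ eq) , w≢v) → inj₂ (inj₁ (eq , w≢v))
       ; (inj₂ (inj₂ eq) , w≢v) → inj₂ (inj₂ (eq , w≢v)) })
    (hasSize-∪
      (λ { (refl , w≢v) (inj₁ (eq , _)) → w≢v (cong (_, y , z) (cong proj₁ eq))
         ; (refl , w≢v) (inj₂ (eq , _)) → w≢v (cong (_, y , z) (cong proj₁ eq)) })
      (moves-size (fixed⇒flipX v) (flipX⇒fixed v) (fixedA? (shift v)))
      (hasSize-∪
        (λ { (refl , w≢v) (eq , _) → w≢v (cong (λ y → x , y , z) (cong (proj₁ ∘ proj₂) eq)) })
        (moves-size (fixed⇒flipY v) (flipY⇒fixed v) (fixedB? (shift v)))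
        (moves-size (fixed⇒flipZ v) (flipZ⇒fixed v) (fixedC? (shift v)))))

  C≡0⇒k≡4 : C ≡ 0# → k ≡ 4#
  C≡0⇒k≡4 C≡0 = x-y≡0⇒x≡y (cancel 2≢0 (combine₂ (- 1ᶠ) 1ᶠ C≡0 C≡4q (solve 2 (λ C q →
    κ 2 :* (κ 4 :- κ 2 :* q :- κ 4) :- κ 0 :=
    (:- κ 1) :* (C :- κ 0) :+ κ 1 :* (C :- κ 4 :* q)) refl C q)))

  C≡8⇒k≡0 : C ≡ fromℕ 8 → k ≡ 0#
  C≡8⇒k≡0 C≡8 = cancel 2≢0 (combine₂ (- 1ᶠ) 1ᶠ C≡8 C≡4q (solve 2 (λ C q →
    κ 2 :* (κ 4 :- κ 2 :* q) :- κ 0 :=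
    (:- κ 1) :* (C :- κ 8) :+ κ 1 :* (C :- κ 4 :* q)) refl C q))

  k≡4⇒C≡0 : k ≡ 4# → C ≡ 0#
  k≡4⇒C≡0 k≡4 = combine₂ (- fromℕ 2) 1ᶠ k≡4 C≡4q (solve 2 (λ C q →
    C :- κ 0 := (:- κ 2) :* (κ 4 :- κ 2 :* q :- κ 4) :+ κ 1 :* (C :- κ 4 :* q)) refl C q)

  k≡0⇒C≡8 : k ≡ 0# → C ≡ fromℕ 8
  k≡0⇒C≡8 k≡0 = combine₂ (- fromℕ 2) 1ᶠ k≡0 C≡4q (solve 2 (λ C q →
    C :- κ 8 := (:- κ 2) :* (κ 4 :- κ 2 :* q :- κ 0) :+ κ 1 :* (C :- κ 4 :* q)) refl C q)

-- The residue field

open import Data.Fin as Fin using (Fin; toℕ)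
open import Data.Fin.Properties using (any?; toℕ-fromℕ<; toℕ-injective; toℕ<n)
open import Data.Nat using (NonZero; _+_; _*_; _∸_; _^_; _≤_; _<_)
open import Data.Nat.Coprimality using (prime⇒coprime; coprime-Bézout)
open import Data.Nat.DivMod using
  (_%_; m%n<n; m%n%n≡m%n; m<n⇒m%n≡m; [m+n]%n≡m%n; [m+kn]%n≡m%n; %-distribˡ-+; %-distribˡ-*)
open import Data.Nat.GCD using (module Bézout)
open import Data.Nat.Primality using (Prime)
open import Defs

module ResidueRing (p : ℕ) .{{_ : NonZero p}} where
  open Residues p

  -- At zero, `p ∸ toℕ x` is `p`, which the outer reduction sends back to zero.
  neg : 𝔽 → 𝔽
  neg x = ⟦ p ∸ toℕ x ⟧

  toℕ-⟦⟧ : ∀ m → toℕ ⟦ m ⟧ ≡ m % p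
  toℕ-⟦⟧ m = toℕ-fromℕ< (m%n<n m p)

  ⟦⟧-cong-% : ∀ {m n} → m % p ≡ n % p → ⟦ m ⟧ ≡ ⟦ n ⟧
  ⟦⟧-cong-% {m} {n} eq = toℕ-injective (trans (toℕ-⟦⟧ m) (trans eq (sym (toℕ-⟦⟧ n))))

  ⟦toℕ⟧ : ∀ x → ⟦ toℕ x ⟧ ≡ x
  ⟦toℕ⟧ x = toℕ-injective (trans (toℕ-⟦⟧ (toℕ x)) (m<n⇒m%n≡m (toℕ<n x)))

  ⟦⟧-injective : ∀ {m n} → m < p → n < p → ⟦ m ⟧ ≡ ⟦ n ⟧ → m ≡ n
  ⟦⟧-injective {m} {n} m<p n<p eq = begin
    m            ≡⟨ m<n⇒m%n≡m m<p ⟨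
    m % p        ≡⟨ toℕ-⟦⟧ m ⟨
    toℕ ⟦ m ⟧    ≡⟨ cong toℕ eq ⟩
    toℕ ⟦ n ⟧    ≡⟨ toℕ-⟦⟧ n ⟩
    n % p        ≡⟨ m<n⇒m%n≡m n<p ⟩
    n            ∎
    where open ≡-Reasoning

  -- Inner reductions may be dropped; with this and its variants the ring laws come down to those of
  -- `ℕ`.
  ⟦⟧-+ˡ : ∀ m n → ⟦ toℕ ⟦ m ⟧ + n ⟧ ≡ ⟦ m + n ⟧
  ⟦⟧-+ˡ m n = ⟦⟧-cong-% (begin
    (toℕ ⟦ m ⟧ + n) % p            ≡⟨ cong (λ l → (l + n) % p) (toℕ-⟦⟧ m) ⟩
    (m % p + n) % p                ≡⟨ %-distribˡ-+ (m % p) n p ⟩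
    (m % p % p + n % p) % p        ≡⟨ cong (λ l → (l + n % p) % p) (m%n%n≡m%n m p) ⟩
    (m % p + n % p) % p            ≡⟨ %-distribˡ-+ m n p ⟨
    (m + n) % p                    ∎)
    where open ≡-Reasoning

  ⟦⟧-*ˡ : ∀ m n → ⟦ toℕ ⟦ m ⟧ * n ⟧ ≡ ⟦ m * n ⟧
  ⟦⟧-*ˡ m n = ⟦⟧-cong-% (begin
    (toℕ ⟦ m ⟧ * n) % p            ≡⟨ cong (λ l → (l * n) % p) (toℕ-⟦⟧ m) ⟩
    (m % p * n) % p                ≡⟨ %-distribˡ-* (m % p) n p ⟩
    (m % p % p * (n % p)) % p      ≡⟨ cong (λ l → (l * (n % p)) % p) (m%n%n≡m%n m p) ⟩
    (m % p * (n % p)) % p          ≡⟨ %-distribˡ-* m n p ⟨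
    (m * n) % p                    ∎)
    where open ≡-Reasoning

  ⟦⟧-+ʳ : ∀ m n → ⟦ m + toℕ ⟦ n ⟧ ⟧ ≡ ⟦ m + n ⟧
  ⟦⟧-+ʳ m n = begin
    ⟦ m + toℕ ⟦ n ⟧ ⟧    ≡⟨ cong ⟦_⟧ (ℕ.+-comm m _) ⟩
    ⟦ toℕ ⟦ n ⟧ + m ⟧    ≡⟨ ⟦⟧-+ˡ n m ⟩
    ⟦ n + m ⟧            ≡⟨ cong ⟦_⟧ (ℕ.+-comm n m) ⟩
    ⟦ m + n ⟧            ∎
    where open ≡-Reasoning

  ⟦⟧-*ʳ : ∀ m n → ⟦ m * toℕ ⟦ n ⟧ ⟧ ≡ ⟦ m * n ⟧
  ⟦⟧-*ʳ m n = begin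
    ⟦ m * toℕ ⟦ n ⟧ ⟧    ≡⟨ cong ⟦_⟧ (ℕ.*-comm m _) ⟩
    ⟦ toℕ ⟦ n ⟧ * m ⟧    ≡⟨ ⟦⟧-*ˡ n m ⟩
    ⟦ n * m ⟧            ≡⟨ cong ⟦_⟧ (ℕ.*-comm n m) ⟩
    ⟦ m * n ⟧            ∎
    where open ≡-Reasoning

  ⟦⟧-+ : ∀ m n → ⟦ m ⟧ +ₚ ⟦ n ⟧ ≡ ⟦ m + n ⟧
  ⟦⟧-+ m n = trans (⟦⟧-+ˡ m _) (⟦⟧-+ʳ m n)

  -- `-ₚ` reduces only once, whereas the subtraction of the ring adds an already reduced negative.
  -- The graph's equation and flips are translated to the ring through this.
  -ₚ≡+neg : ∀ x y → x -ₚ y ≡ x +ₚ neg y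
  -ₚ≡+neg x y = sym (⟦⟧-+ʳ (toℕ x) (p ∸ toℕ y))

  +ₚ-comm : ∀ x y → x +ₚ y ≡ y +ₚ x
  +ₚ-comm x y = cong ⟦_⟧ (ℕ.+-comm (toℕ x) (toℕ y))

  *ₚ-comm : ∀ x y → x *ₚ y ≡ y *ₚ x
  *ₚ-comm x y = cong ⟦_⟧ (ℕ.*-comm (toℕ x) (toℕ y))

  +ₚ-assoc : ∀ x y z → (x +ₚ y) +ₚ z ≡ x +ₚ (y +ₚ z)
  +ₚ-assoc x y z = begin
    (x +ₚ y) +ₚ z                    ≡⟨ ⟦⟧-+ˡ (toℕ x + toℕ y) (toℕ z) ⟩
    ⟦ toℕ x + toℕ y + toℕ z ⟧        ≡⟨ cong ⟦_⟧ (ℕ.+-assoc (toℕ x) (toℕ y) (toℕ z)) ⟩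
    ⟦ toℕ x + (toℕ y + toℕ z) ⟧      ≡⟨ ⟦⟧-+ʳ (toℕ x) (toℕ y + toℕ z) ⟨
    x +ₚ (y +ₚ z)                    ∎
    where open ≡-Reasoning

  *ₚ-assoc : ∀ x y z → (x *ₚ y) *ₚ z ≡ x *ₚ (y *ₚ z)
  *ₚ-assoc x y z = begin
    (x *ₚ y) *ₚ z                    ≡⟨ ⟦⟧-*ˡ (toℕ x * toℕ y) (toℕ z) ⟩
    ⟦ toℕ x * toℕ y * toℕ z ⟧        ≡⟨ cong ⟦_⟧ (ℕ.*-assoc (toℕ x) (toℕ y) (toℕ z)) ⟩
    ⟦ toℕ x * (toℕ y * toℕ z) ⟧      ≡⟨ ⟦⟧-*ʳ (toℕ x) (toℕ y * toℕ z) ⟨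
    x *ₚ (y *ₚ z)                    ∎
    where open ≡-Reasoning

  +ₚ-identityˡ : ∀ x → ⟦ 0 ⟧ +ₚ x ≡ x
  +ₚ-identityˡ x = trans (⟦⟧-+ˡ 0 (toℕ x)) (⟦toℕ⟧ x)

  *ₚ-identityˡ : ∀ x → ⟦ 1 ⟧ *ₚ x ≡ x
  *ₚ-identityˡ x = begin
    ⟦ 1 ⟧ *ₚ x        ≡⟨ ⟦⟧-*ˡ 1 (toℕ x) ⟩
    ⟦ 1 * toℕ x ⟧     ≡⟨ cong ⟦_⟧ (ℕ.*-identityˡ (toℕ x)) ⟩
    ⟦ toℕ x ⟧         ≡⟨ ⟦toℕ⟧ x ⟩
    x                 ∎
    where open ≡-Reasoning

  neg-inverseʳ : ∀ x → x +ₚ neg x ≡ ⟦ 0 ⟧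
  neg-inverseʳ x = begin
    x +ₚ neg x                        ≡⟨ -ₚ≡+neg x x ⟨
    ⟦ toℕ x + (p ∸ toℕ x) ⟧          ≡⟨ cong ⟦_⟧ (ℕ.m+[n∸m]≡n (ℕ.<⇒≤ (toℕ<n x))) ⟩
    ⟦ p ⟧                            ≡⟨ ⟦⟧-cong-% ([m+n]%n≡m%n 0 p) ⟩
    ⟦ 0 ⟧                            ∎
    where open ≡-Reasoning

  *ₚ-distribˡ-+ₚ : ∀ x y z → x *ₚ (y +ₚ z) ≡ x *ₚ y +ₚ x *ₚ z
  *ₚ-distribˡ-+ₚ x y z = begin
    x *ₚ (y +ₚ z)                            ≡⟨ ⟦⟧-*ʳ (toℕ x) (toℕ y + toℕ z) ⟩
    ⟦ toℕ x * (toℕ y + toℕ z) ⟧              ≡⟨ cong ⟦_⟧ (ℕ.*-distribˡ-+ (toℕ x) (toℕ y) (toℕ z)) ⟩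
    ⟦ toℕ x * toℕ y + toℕ x * toℕ z ⟧        ≡⟨ ⟦⟧-+ (toℕ x * toℕ y) (toℕ x * toℕ z) ⟨
    x *ₚ y +ₚ x *ₚ z                         ∎
    where open ≡-Reasoning

  isCommutativeRing : IsCommutativeRing _≡_ _+ₚ_ _*ₚ_ neg ⟦ 0 ⟧ ⟦ 1 ⟧
  isCommutativeRing = record
    { isRing = record
      { +-isAbelianGroup = record
        { isGroup = record
          { isMonoid = record
            { isSemigroup = record
              { isMagma = record { isEquivalence = isEquivalence ; ∙-cong = cong₂ _+ₚ_ }
              ; assoc   = +ₚ-assoc
              }
            ; identity = +ₚ-identityˡ , λ x → trans (+ₚ-comm x _) (+ₚ-identityˡ x)
            }
          ; inverse = (λ x → trans (+ₚ-comm _ x) (neg-inverseʳ x)) , neg-inverseʳ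
          ; ⁻¹-cong = cong neg
          }
        ; comm = +ₚ-comm
        }
      ; *-cong     = cong₂ _*ₚ_
      ; *-assoc    = *ₚ-assoc
      ; *-identity = *ₚ-identityˡ , λ x → trans (*ₚ-comm x _) (*ₚ-identityˡ x)
      ; distrib    = *ₚ-distribˡ-+ₚ , λ x y z → trans (*ₚ-comm (y +ₚ z) x)
          (trans (*ₚ-distribˡ-+ₚ x y z) (cong₂ _+ₚ_ (*ₚ-comm x y) (*ₚ-comm x z)))
      }
    ; *-comm = *ₚ-comm
    }

  commutativeRing : CommutativeRing _ _
  commutativeRing = record { isCommutativeRing = isCommutativeRing }

  -- Matches the solver's numerals with the residues named in the theorem.
  fromℕ≡⟦⟧ : ∀ n → IntegerSolver.fromℕ commutativeRing n ≡ ⟦ n ⟧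
  fromℕ≡⟦⟧ zero    = refl
  fromℕ≡⟦⟧ (suc n) = trans (cong (⟦ 1 ⟧ +ₚ_) (fromℕ≡⟦⟧ n)) (⟦⟧-+ 1 n)

  all-size : HasSize {𝔽} (λ _ → ⊤) p
  all-size = record
    { elements = allFin p
    ; unique   = Unique.allFin⁺ p
    ; sound    = λ _ → tt
    ; complete = λ {x} _ → ∈-allFin x
    ; size     = length-tabulate (λ (x : 𝔽) → x)
    }

  -- The default value of the search occurs only when no inverse exists.
  ⁻¹-inverseʳ : ∀ {x} → ∃ (λ y → x *ₚ y ≡ ⟦ 1 ⟧) → x *ₚ x ⁻¹ ≡ ⟦ 1 ⟧
  ⁻¹-inverseʳ {x} exists with any? (λ y → x *ₚ y Fin.≟ ⟦ 1 ⟧)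
  ... | yes (_ , xy≡1) = xy≡1
  ... | no  none       = ⊥-elim (none exists)

  module _ (p-prime : Prime p) where

    -- Bézout over `ℕ` comes with two signs: `1 + ap = bx` gives the inverse `b`, and `1 + bx = ap`
    -- gives `-b`.
    invertible : ∀ {x} → x ≢ ⟦ 0 ⟧ → ∃ (λ y → x *ₚ y ≡ ⟦ 1 ⟧)
    invertible {x} x≢0 with coprime-Bézout (prime⇒coprime p-prime {{toℕ-nonZero}} (toℕ<n x))
      where
      toℕ-nonZero : NonZero (toℕ x)
      toℕ-nonZero = ℕ.≢-nonZero (λ toℕx≡0 → x≢0 (trans (sym (⟦toℕ⟧ x)) (cong ⟦_⟧ toℕx≡0)))
    ... | Bézout.-+ a b 1+ap≡bx = ⟦ b ⟧ , (begin
      x *ₚ ⟦ b ⟧            ≡⟨ ⟦⟧-*ʳ (toℕ x) b ⟩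
      ⟦ toℕ x * b ⟧         ≡⟨ cong ⟦_⟧ (ℕ.*-comm (toℕ x) b) ⟩
      ⟦ b * toℕ x ⟧         ≡⟨ cong ⟦_⟧ 1+ap≡bx ⟨
      ⟦ 1 + a * p ⟧         ≡⟨ ⟦⟧-cong-% ([m+kn]%n≡m%n 1 a p) ⟩
      ⟦ 1 ⟧                 ∎)
      where open ≡-Reasoning
    ... | Bézout.+- a b 1+bx≡ap = neg ⟦ b ⟧ , (begin
      x *ₚ neg ⟦ b ⟧         ≡⟨ -‿distribʳ-* x ⟦ b ⟧ ⟨
      neg (x *ₚ ⟦ b ⟧)       ≡⟨ neg-cong ⟩
      neg ⟦ b * toℕ x ⟧      ≡⟨ +-inverseˡ-unique _ _ 1+bx≡0 ⟨
      ⟦ 1 ⟧                 ∎)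
      where
      open ≡-Reasoning
      open Algebra.Properties.Ring (CommutativeRing.ring commutativeRing)

      neg-cong : neg (x *ₚ ⟦ b ⟧) ≡ neg ⟦ b * toℕ x ⟧
      neg-cong = cong neg (trans (⟦⟧-*ʳ (toℕ x) b) (cong ⟦_⟧ (ℕ.*-comm (toℕ x) b)))

      1+bx≡0 : ⟦ 1 ⟧ +ₚ ⟦ b * toℕ x ⟧ ≡ ⟦ 0 ⟧
      1+bx≡0 = begin
        ⟦ 1 ⟧ +ₚ ⟦ b * toℕ x ⟧    ≡⟨ ⟦⟧-+ 1 (b * toℕ x) ⟩
        ⟦ 1 + b * toℕ x ⟧         ≡⟨ cong ⟦_⟧ 1+bx≡ap ⟩
        ⟦ a * p ⟧                 ≡⟨ ⟦⟧-cong-% ([m+kn]%n≡m%n 0 a p) ⟩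
        ⟦ 0 ⟧                     ∎

    residueField : 2 < p → OddField
    residueField 2<p = record
      { F                 = 𝔽
      ; isCommutativeRing = isCommutativeRing
      ; _≟_               = Fin._≟_
      ; inv               = _⁻¹
      ; *-inverseʳ        = λ {x} x≢0 → ⁻¹-inverseʳ {x} (invertible x≢0)
      ; 2≢0               = λ 2≡0 →
          ℕ.1+n≢0 (⟦⟧-injective 2<p 0<p (trans (sym (fromℕ≡⟦⟧ 2)) 2≡0))
      ; 1≢0               = λ 1≡0 → ℕ.1+n≢0 (⟦⟧-injective (ℕ.<-trans (ℕ.n<1+n 1) 2<p) 0<p 1≡0)
      }
      where
      0<p : 0 < p
      0<p = ℕ.<-trans ℕ.z<s 2<p

-- The Vieta graph

module DegreeArithmetic where
  open +-*-Solver

  triple₄ : ∀ r → ((3 + r) + (3 + r)) + (((3 + r) + (3 + r)) + ((3 + r) + (3 + r))) ≡ 6 * (3 + r)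
  triple₄ = solve 1 (λ r → ((con 3 :+ r) :+ (con 3 :+ r)) :+ (((con 3 :+ r) :+ (con 3 :+ r)) :+ ((con 3 :+ r) :+ (con 3 :+ r)))
    := con 6 :* (con 3 :+ r)) refl

  triple₀ : ∀ r → (4 + r + 0) + ((4 + r + 0) + (4 + r + 0)) ≡ 3 * (4 + r)
  triple₀ = solve 1 (λ r → (con 4 :+ r :+ con 0) :+ ((con 4 :+ r :+ con 0) :+ (con 4 :+ r :+ con 0))
    := con 3 :* (con 4 :+ r)) refl

  triple : ∀ r → (3 + r + 0) + ((3 + r + 0) + (3 + r + 0)) ≡ 3 * (3 + r)
  triple = solve 1 (λ r → (con 3 :+ r :+ con 0) :+ ((con 3 :+ r :+ con 0) :+ (con 3 :+ r :+ con 0))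
    := con 3 :* (con 3 :+ r)) refl

  triple′ : ∀ r → (3 + r) + ((3 + r) + (3 + r)) ≡ 3 * (3 + r)
  triple′ = solve 1 (λ r → (con 3 :+ r) :+ ((con 3 :+ r) :+ (con 3 :+ r))
    := con 3 :* (con 3 :+ r)) refl

  triple″ : ∀ r → (2 + r) + ((2 + r) + (2 + r)) ≡ 3 * (2 + r)
  triple″ = solve 1 (λ r → (con 2 :+ r) :+ ((con 2 :+ r) :+ (con 2 :+ r))
    := con 3 :* (con 2 :+ r)) refl

  -- The left side keeps the unsimplified sum of the sizes for degrees 0, 1 and 2; the 8 subtracted
  -- in the theorem is added here and moved over by `+⇒∸`.
  deficient₄ : ∀ r → 4 + ((((3 + r) + (3 + r)) + (((3 + r) + (3 + r)) + ((3 + r) + (3 + r)))) + 0) + 8 ≡ 6 * (5 + r)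
  deficient₄ = solve 1 (λ r → con 4 :+ ((((con 3 :+ r) :+ (con 3 :+ r)) :+ (((con 3 :+ r) :+ (con 3 :+ r)) :+ ((con 3 :+ r) :+ (con 3 :+ r)))) :+ con 0) :+ con 8
    := con 6 :* (con 5 :+ r)) refl

  deficient₀ : ∀ r → 1 + (((4 + r + 0) + ((4 + r + 0) + (4 + r + 0))) + ((3 + r) + ((3 + r) + (3 + r)))) + 8 ≡ 6 * (5 + r)
  deficient₀ = solve 1 (λ r → con 1 :+ (((con 4 :+ r :+ con 0) :+ ((con 4 :+ r :+ con 0) :+ (con 4 :+ r :+ con 0))) :+ ((con 3 :+ r) :+ ((con 3 :+ r) :+ (con 3 :+ r)))) :+ con 8
    := con 6 :* (con 5 :+ r)) refl

  deficient : ∀ r → 3 + (((3 + r + 0) + ((3 + r + 0) + (3 + r + 0))) + ((2 + r) + ((2 + r) + (2 + r)))) + 12 ≡ 6 * (5 + r)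
  deficient = solve 1 (λ r → con 3 :+ (((con 3 :+ r :+ con 0) :+ ((con 3 :+ r :+ con 0) :+ (con 3 :+ r :+ con 0))) :+ ((con 2 :+ r) :+ ((con 2 :+ r) :+ (con 2 :+ r)))) :+ con 12
    := con 6 :* (con 5 :+ r)) refl

module VietaCount (p : ℕ) .{{_ : NonZero p}} (p-prime : Prime p) (2<p : 2 < p) (C D q : Fin p)
  (isParametrised : VietaParameters.IsParametrised (ResidueRing.residueField p p-prime 2<p) C D q)
  where
  private
    K : OddField
    K = ResidueRing.residueField p p-prime 2<p
  open Residues p
  open ResidueRing p
  open VietaGraph p C D
  open VietaCubic K C D q isParametrised
  open SurfaceCount K k using (moved; OfDegree)
  open Surface K k using (OnSurface)

  isSolution⇒solution : ∀ v → IsSolution v → Solution v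
  isSolution⇒solution (x , y , z) sol = trans sol (cong (_+ₚ D) (-ₚ≡+neg (x *ₚ y *ₚ z) (C *ₚ (x +ₚ y +ₚ z))))

  solution⇒isSolution : ∀ v → Solution v → IsSolution v
  solution⇒isSolution (x , y , z) sol = trans sol (sym (cong (_+ₚ D) (-ₚ≡+neg (x *ₚ y *ₚ z) (C *ₚ (x +ₚ y +ₚ z)))))

  flip-coordinate : ∀ e x → e -ₚ C -ₚ x ≡ e +ₚ neg C +ₚ neg x
  flip-coordinate e x = trans (-ₚ≡+neg (e -ₚ C) x) (cong (_+ₚ neg x) (-ₚ≡+neg e C))

  ∈-flips⇒isFlip : ∀ {v w} → w ∈ flips v → IsFlip v w
  ∈-flips⇒isFlip {x , y , z} (here refl) =
    inj₁ (cong (_, y , z) (flip-coordinate (y *ₚ z) x))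
  ∈-flips⇒isFlip {x , y , z} (there (here refl)) =
    inj₂ (inj₁ (cong (λ y → x , y , z) (flip-coordinate (x *ₚ z) y)))
  ∈-flips⇒isFlip {x , y , z} (there (there (here refl))) =
    inj₂ (inj₂ (cong (λ z → x , y , z) (flip-coordinate (x *ₚ y) z)))

  isFlip⇒∈-flips : ∀ {v w} → IsFlip v w → w ∈ flips v
  isFlip⇒∈-flips {x , y , z} (inj₁ refl) =
    here (cong (_, y , z) (sym (flip-coordinate (y *ₚ z) x)))
  isFlip⇒∈-flips {x , y , z} (inj₂ (inj₁ refl)) =
    there (here (cong (λ y → x , y , z) (sym (flip-coordinate (x *ₚ z) y))))
  isFlip⇒∈-flips {x , y , z} (inj₂ (inj₂ refl)) =
    there (there (here (cong (λ z → x , y , z) (sym (flip-coordinate (x *ₚ y) z)))))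

  -- The enumeration built by `hasSize-×` and `hasSize-filter` is definitionally the list
  -- `vertices`.
  vertices-size : HasSize ((λ _ → ⊤ × ⊤ × ⊤) ∩ IsSolution) #vertices
  vertices-size = hasSize-filter isSolution? (hasSize-× all-size (hasSize-× all-size all-size))

  -- Neighbours are counted once inside `vertices` and once as moving flips. The counts agree
  -- because a flip of a solution is again a solution, hence a vertex.
  degree≡moved : ∀ {v} → IsSolution v → degree v ≡ moved (shift v)
  degree≡moved {v} sol = hasSize-unique
    (hasSize-filter (adjacent? v) vertices-size)
    (hasSize-cong
      (λ {w} (flip , w≢v) →
          (_ , solution⇒isSolution w (isFlip-solution flip (isSolution⇒solution v sol)))
        , (w≢v ∘ sym) , inj₁ (isFlip⇒∈-flips flip))
      (λ (_ , v≢w , adj) →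
          [ ∈-flips⇒isFlip , isFlip-sym ∘ ∈-flips⇒isFlip ]′ adj , (v≢w ∘ sym))
      (neighbours-size v))

  #vertices≡ : ∀ {n} → HasSize OnSurface n → #vertices ≡ n
  #vertices≡ size = hasSize-unique vertices-size (hasSize-bij unshift shift
    (λ {v} on → _ , solution⇒isSolution (unshift v)
      (onSurface⇒solution (unshift v) (subst OnSurface (sym (shift-unshift v)) on)))
    (λ {v} (_ , sol) → solution⇒onSurface v (isSolution⇒solution v sol))
    (λ {v} _ → shift-unshift v) (λ {v} _ → unshift-shift v) size)

  module _ {Q : ℕ → Set} (Q? : ∀ n → Dec (Q n)) where

    -- A general `Q` covers both `#ofDegree`, by equality with `d`, and `#deficient`, by `< 3`.
    degree-count : ∀ {n} → HasSize (λ v → OnSurface v × Q (moved v)) n →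
                   length (filter (λ v → Q? (degree v)) vertices) ≡ n
    degree-count size = hasSize-unique (hasSize-filter (Q? ∘ degree) vertices-size)
      (hasSize-bij unshift shift
        (λ {v} (on , Qv) →
          let on′  = subst OnSurface (sym (shift-unshift v)) on
              sol  = solution⇒isSolution (unshift v) (onSurface⇒solution (unshift v) on′)
          in (_ , sol) , subst Q (sym (trans (degree≡moved sol) (cong moved (shift-unshift v)))) Qv)
        (λ {v} ((_ , sol) , Qv) →
            solution⇒onSurface v (isSolution⇒solution v sol)
          , subst Q (degree≡moved sol) Qv)
        (λ {v} _ → shift-unshift v) (λ {v} _ → unshift-shift v) size)

  #ofDegree≡ : ∀ d {n} → HasSize (OfDegree d) n → #ofDegree d ≡ n
  #ofDegree≡ d = degree-count (λ n → n ℕ.≟ d)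

  #deficient≡ : ∀ {m n o} → HasSize (OfDegree 0) m → HasSize (OfDegree 1) n →
                HasSize (OfDegree 2) o → #deficient ≡ m + (n + o)
  #deficient≡ size₀ size₁ size₂ = degree-count (ℕ._<? 3) (hasSize-<3 size₀ size₁ size₂)

  module Cases (r : ℕ) (p≡5+r : p ≡ 5 + r) where
    open FieldArithmetic K using (0#; 4≢0; fromℕ)
    open TotalCount K k (subst (HasSize {Fin p} (λ _ → ⊤)) p≡5+r all-size)
    open DegreeArithmetic

    private
      -- Sizes come out at `5 + r`; they are carried back to `p` as numbers, so that the field over
      -- `Fin p` stays untouched.
      at-p : (f : ℕ → ℕ) → ∀ {x} → x ≡ f (5 + r) → x ≡ f p
      at-p f eq = trans eq (cong f (sym p≡5+r))

      +⇒∸ : ∀ {m o} n → m + n ≡ o → m ≡ o ∸ n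
      +⇒∸ {m} n refl = sym (ℕ.m+n∸n≡m m n)

    open SurfaceCount K k
    open Surface K k

    case-C≡0 : C ≡ 0# →
        #vertices ≡ p ^ 2 + 1
      × #deficient ≡ 6 * p ∸ 8
      × #ofDegree 2 ≡ 0
      × #ofDegree 1 ≡ 6 * (p ∸ 2)
      × #ofDegree 0 ≡ 4
    case-C≡0 C≡0 =
        at-p (λ p → p ^ 2 + 1) (#vertices≡ (onSurface-size₄ k≡4))
      , at-p (λ p → 6 * p ∸ 8) (trans (#deficient≡ size₀ size₁ size₂) (+⇒∸ 8 (deficient₄ r)))
      , #ofDegree≡ 2 size₂
      , at-p (λ p → 6 * (p ∸ 2)) (trans (#ofDegree≡ 1 size₁) (triple₄ r))
      , #ofDegree≡ 0 size₀
      where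
      k≡4   = C≡0⇒k≡4 C≡0
      size₀ = ofDegree0-size (fixedAll-size₄ k≡4)
      size₁ = ofDegree1-size (movedOnlyA-size₄ k≡4
                (nonzero-≢k-size (λ k≡0 → 4≢0 (trans (sym k≡4) k≡0))))
      size₂ = ofDegree2-size (fixedOnlyA-empty k≡4)

    case-C≡8 : C ≡ fromℕ 8 →
        #vertices ≡ p ^ 2 + 1
      × #deficient ≡ 6 * p ∸ 8
      × #ofDegree 2 ≡ 3 * (p ∸ 2)
      × #ofDegree 1 ≡ 3 * (p ∸ 1)
      × #ofDegree 0 ≡ 1
    case-C≡8 C≡8 =
        at-p (λ p → p ^ 2 + 1) (#vertices≡ (onSurface-size₀ k≡0))
      , at-p (λ p → 6 * p ∸ 8) (trans (#deficient≡ size₀ size₁ size₂) (+⇒∸ 8 (deficient₀ r)))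
      , at-p (λ p → 3 * (p ∸ 2)) (trans (#ofDegree≡ 2 size₂) (triple′ r))
      , at-p (λ p → 3 * (p ∸ 1)) (trans (#ofDegree≡ 1 size₁) (triple₀ r))
      , #ofDegree≡ 0 size₀
      where
      k≡0   = C≡8⇒k≡0 C≡8
      k≢4   = λ k≡4 → 4≢0 (trans (sym k≡4) k≡0)
      size₀ = ofDegree0-size (fixedAll-size₀ k≡0)
      size₁ = ofDegree1-size (movedOnlyA-size k≢4 (nonzero-≢k-size₀ k≡0))
      size₂ = ofDegree2-size (fixedOnlyA-size k≢4
                (nonzero-≢k,4-size k≢4 (nonzero-≢k-size₀ k≡0)))

    case-C≢0,8 : C ≢ 0# → C ≢ fromℕ 8 →
        (#vertices ≡ p ^ 2 + 1 + p ⊎ #vertices ≡ p ^ 2 + 1 ∸ p)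
      × #deficient ≡ 6 * p ∸ 12
      × #ofDegree 2 ≡ 3 * (p ∸ 3)
      × #ofDegree 1 ≡ 3 * (p ∸ 2)
      × #ofDegree 0 ≡ 3
    case-C≢0,8 C≢0 C≢8 =
        [ (λ size → inj₁ (at-p (λ p → p ^ 2 + 1 + p) (#vertices≡ size)))
        , (λ size → inj₂ (at-p (λ p → p ^ 2 + 1 ∸ p) (#vertices≡ size))) ]′
        (onSurface-size± k≢0 k≢4)
      , at-p (λ p → 6 * p ∸ 12) (trans (#deficient≡ size₀ size₁ size₂) (+⇒∸ 12 (deficient r)))
      , at-p (λ p → 3 * (p ∸ 3)) (trans (#ofDegree≡ 2 size₂) (triple″ r))
      , at-p (λ p → 3 * (p ∸ 2)) (trans (#ofDegree≡ 1 size₁) (triple r))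
      , #ofDegree≡ 0 size₀
      where
      k≢0   = C≢8 ∘ k≡0⇒C≡8
      k≢4   = C≢0 ∘ k≡4⇒C≡0
      size₀ = ofDegree0-size (fixedAll-size k≢0 k≢4)
      size₁ = ofDegree1-size (movedOnlyA-size k≢4 (nonzero-≢k-size k≢0))
      size₂ = ofDegree2-size (fixedOnlyA-size k≢4
                (nonzero-≢k,4-size k≢4 (nonzero-≢k-size k≢0)))

theorem11p2 : (p : ℕ) .{{_ : NonZero p}} → Prime p → 5 ≤ p → (C : Fin p) →
    let open Residues p
        D = ⟦ 4 ⟧ -ₚ ⟦ 2 ⟧ *ₚ C -ₚ (C *ₚ C) /ₚ ⟦ 4 ⟧
        open VietaGraph p C D
    in
      (C ≡ ⟦ 0 ⟧ →
          #vertices ≡ p ^ 2 + 1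
        × #deficient ≡ 6 * p ∸ 8
        × #ofDegree 2 ≡ 0
        × #ofDegree 1 ≡ 6 * (p ∸ 2)
        × #ofDegree 0 ≡ 4)
    × (C ≡ ⟦ 8 ⟧ →
          #vertices ≡ p ^ 2 + 1
        × #deficient ≡ 6 * p ∸ 8
        × #ofDegree 2 ≡ 3 * (p ∸ 2)
        × #ofDegree 1 ≡ 3 * (p ∸ 1)
        × #ofDegree 0 ≡ 1)
    × (C ≢ ⟦ 0 ⟧ → C ≢ ⟦ 8 ⟧ →
          (#vertices ≡ p ^ 2 + 1 + p ⊎ #vertices ≡ p ^ 2 + 1 ∸ p)
        × #deficient ≡ 6 * p ∸ 12
        × #ofDegree 2 ≡ 3 * (p ∸ 3)
        × #ofDegree 1 ≡ 3 * (p ∸ 2)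
        × #ofDegree 0 ≡ 3)
theorem11p2 p p-prime 5≤p C =
    case-C≡0
  -- The residue 8 has to be converted to `fromℕ 8`, while zero agrees by definition.
  , (λ C≡8 → case-C≡8 (trans C≡8 (sym (fromℕ≡⟦⟧ 8))))
  , (λ C≢0 C≢8 → case-C≢0,8 C≢0 (λ C≡8 → C≢8 (trans C≡8 (fromℕ≡⟦⟧ 8))))
  where
  open Residues p
  open ResidueRing p hiding (commutativeRing; isCommutativeRing)

  2<p : 2 < p
  2<p = ℕ.≤-trans (s≤s (s≤s (s≤s z≤n))) 5≤p

  K = residueField p-prime 2<p
  open FieldArithmetic K

  q D : 𝔽
  q = C /ₚ ⟦ 4 ⟧
  D = ⟦ 4 ⟧ -ₚ ⟦ 2 ⟧ *ₚ C -ₚ (C *ₚ C) /ₚ ⟦ 4 ⟧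

  C≡4q : C ≡ 4# *ₚ q
  C≡4q = begin
    C                              ≡⟨ div-* {x = C} 4≢0 ⟨
    C / 4# *ₚ 4#                   ≡⟨ *ₚ-comm (C / 4#) 4# ⟩
    4# *ₚ (C / 4#)                 ≡⟨ cong (λ i → 4# *ₚ (C /ₚ i)) (fromℕ≡⟦⟧ 4) ⟩
    4# *ₚ q                        ∎
    where open ≡-Reasoning

  -- By associativity `C²/4` is `C * q`; substituting `C = 4q` then removes the division and leaves
  -- an identity of polynomials in `q`.
  D≡ : D ≡ 4# - fromℕ 8 *ₚ q - 4# *ₚ (q *ₚ q)
  D≡ = begin
    D
      ≡⟨ -ₚ≡+neg (⟦ 4 ⟧ -ₚ ⟦ 2 ⟧ *ₚ C) ((C *ₚ C) /ₚ ⟦ 4 ⟧) ⟩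
    (⟦ 4 ⟧ -ₚ ⟦ 2 ⟧ *ₚ C) - (C *ₚ C) /ₚ ⟦ 4 ⟧
      ≡⟨ cong₂ _-_ (-ₚ≡+neg ⟦ 4 ⟧ (⟦ 2 ⟧ *ₚ C)) (*ₚ-assoc C C (⟦ 4 ⟧ ⁻¹)) ⟩
    ⟦ 4 ⟧ - ⟦ 2 ⟧ *ₚ C - C *ₚ q
      ≡⟨ cong₂ (λ four two → four - two *ₚ C - C *ₚ q) (fromℕ≡⟦⟧ 4) (fromℕ≡⟦⟧ 2) ⟨
    4# - fromℕ 2 *ₚ C - C *ₚ q
      ≡⟨ cong (λ C → 4# - fromℕ 2 *ₚ C - C *ₚ q) C≡4q ⟩
    4# - fromℕ 2 *ₚ (4# *ₚ q) - 4# *ₚ q *ₚ q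
      ≡⟨ solve 1 (λ q → κ 4 :- κ 2 :* (κ 4 :* q) :- κ 4 :* q :* q :=
                        κ 4 :- κ 8 :* q :- κ 4 :* (q :* q)) refl q ⟩
    4# - fromℕ 8 *ₚ q - 4# *ₚ (q *ₚ q) ∎
    where open ≡-Reasoning

  isParametrised : VietaParameters.IsParametrised K C D q
  isParametrised = record { C≡4q = C≡4q ; D≡ = D≡ }

  open VietaCount p p-prime 2<p C D q isParametrised
  open Cases (p ∸ 5) (sym (ℕ.m+[n∸m]≡n 5≤p))
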